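{- Let $k > 2$ be an integer and let $d_0, \varepsilon > 0$ be real numbers. Then there exist an integer $d > d_0$ and a finite $d$-regular linear $k$-graph $H$ containing two vertices $v_1, v_2 \in V(H)$ such that \begin{itemize} \item $\mathcal{P}_H(\overline{v_1}) > 1 - \frac{1 + \varepsilon}{d^{k - 2}}$, and \item $\mathcal{P}_H(\overline{v_2}) < \frac{1 + \varepsilon}{d+1}$. \end{itemize}
   Context: A $k$-graph is a $k$-uniform hypergraph. It is linear if any two distinct edges share at most one vertex, and $d$-regular if every vertex lies in exactly $d$ edges. A matching is a set of pairwise vertex-disjoint edges; the empty set is a matching. For a finite $k$-graph $H$, let $M$ be a matching chosen uniformly at random from the set of all matchings of $H$. For $v \in V(H)$, $\mathcal{P}_H(\overline{v})$ denotes the probability that $M$ does not cover $v$, i.e. that no edge of $M$ contains $v$. -}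

module Defs where

open import Data.Nat using (ℕ; zero; suc; _≤_)
open import Data.Fin using (Fin; _≟_)
open import Data.Fin.Subset using (Subset; _∈_; _∉_; _∩_; ∣_∣; Empty; outside; inside)
open import Data.Fin.Subset.Properties using (_∈?_)
open import Data.Fin.Properties using (all?; any?)
open import Data.Vec using (Vec; []; _∷_)
open import Data.List using (List; []; _∷_; [_]; _++_; map; length; filter)
open import Data.Integer using (+_)
open import Data.Rational using (ℚ; 0ℚ; _/_)
open import Data.Product using (∃; _,_)
open import Data.Empty using (⊥-elim)
open import Relation.Nullary using (¬_; Dec; yes; no)
open import Relation.Nullary.Decidable using (¬?)
open import Relation.Binary.PropositionalEquality using (_≡_; _≢_)

record Hypergraph : Set where
  field
    n    : ℕ
    m    : ℕ
    edge : Fin m → Subset n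
open Hypergraph public

Uniform : ℕ → Hypergraph → Set
Uniform k H = ∀ i → ∣ edge H i ∣ ≡ k

-- any two distinct edges share at most one vertex
-- (for k ≥ 2 this also forces the edges to be distinct sets)
Linear : Hypergraph → Set
Linear H = ∀ i j → i ≢ j → ∣ edge H i ∩ edge H j ∣ ≤ 1

degree : (H : Hypergraph) → Fin (n H) → ℕ
degree H v = length (filter (λ i → v ∈? edge H i) (Data.List.allFin (m H)))
  where import Data.List

Regular : ℕ → Hypergraph → Set
Regular d H = ∀ v → degree H v ≡ d

IsMatching : (H : Hypergraph) → Subset (m H) → Set
IsMatching H S = ∀ i j → i ∈ S → j ∈ S → i ≢ j → Empty (edge H i ∩ edge H j)

Covers : (H : Hypergraph) → Subset (m H) → Fin (n H) → Set
Covers H S v = ∃ λ i → i ∈ S × v ∈ edge H i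
  where open import Data.Product using (_×_)

allSubsets : (m : ℕ) → List (Subset m)
allSubsets zero    = [ [] ]
allSubsets (suc m) = map (outside ∷_) (allSubsets m) ++ map (inside ∷_) (allSubsets m)

private
  empty? : ∀ {k} (p : Subset k) → Dec (Empty p)
  empty? {k} p with any? {n = k} (_∈? p)
  ... | yes q = no (λ e → e q)
  ... | no q  = yes q


matchDec : (H : Hypergraph) (S : Subset (m H)) (i j : Fin (m H)) →
           Dec (i ∈ S → j ∈ S → i ≢ j → Empty (edge H i ∩ edge H j))
matchDec H S i j with i ∈? S | j ∈? S | i ≟ j | empty? (edge H i ∩ edge H j)
... | no ¬a | _ | _ | _ = yes (λ a → ⊥-elim (¬a a))
... | yes a | no ¬b | _ | _ = yes (λ _ b → ⊥-elim (¬b b))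
... | yes a | yes b | yes eq | _ = yes (λ _ _ ne → ⊥-elim (ne eq))
... | yes a | yes b | no ne | yes e = yes (λ _ _ _ → e)
... | yes a | yes b | no ne | no ¬e = no (λ f → ¬e (f a b ne))

isMatching? : (H : Hypergraph) (S : Subset (m H)) → Dec (IsMatching H S)
isMatching? H S with all? {n = m H} (λ i → all? {n = m H} (λ j → matchDec H S i j))
... | yes f = yes (λ i j → f i j)
... | no ¬f = no (λ g → ¬f (λ i j → g i j))

covers? : (H : Hypergraph) (S : Subset (m H)) (v : Fin (n H)) → Dec (Covers H S v)
covers? H S v = any? {n = m H} (λ i → dec i)
  where
  open import Data.Product using (_×_)
  open import Relation.Nullary.Decidable using (_×-dec_)
  dec : ∀ i → Dec (i ∈ S × v ∈ edge H i)
  dec i = (i ∈? S) ×-dec (v ∈? edge H i)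

matchings : (H : Hypergraph) → List (Subset (m H))
matchings H = filter (isMatching? H) (allSubsets (m H))

-- a/b as a rational; the b = 0 branch is never used below, since the
-- empty matching always exists, so the number of matchings is ≥ 1.
frac : ℕ → ℕ → ℚ
frac a zero    = 0ℚ
frac a (suc b) = (+ a) / suc b

-- P_H(v̄): probability that a uniformly random matching does not cover v
Puncov : (H : Hypergraph) → Fin (n H) → ℚ
Puncov H v = frac (length (filter (λ S → ¬? (covers? H S v)) (matchings H)))
                  (length (matchings H))

-- 1/x for natural x (with 1/0 := 0; only used for x ≥ 1)
inv : ℕ → ℚ
inv zero    = 0ℚ
inv (suc x) = (+ 1) / suc x

{-# OPTIONS --safe #-}
-- For a tree-like graph the probability x that the root stays uncovered evolves,
-- when m = k − 1 copies hang from each of the c edges of a new root, by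
-- x ↦ 1 / (1 + c xᵐ). For m ≥ 2 the fixed point of this map is repelling, and the
-- iterates started anywhere else approach a 2-cycle with values close to 1/c and to
-- 1 − c^(1−m). Choosing c = Nᵏ makes the fixed point irrational, so the iteration
-- may start from any finite rooted graph whose degrees are c at the root and c + 1
-- elsewhere. Such a graph is obtained, for k ∣ c, from regular grids with one edge removed.
module Submission where

-- A truncated tree has leaves of degree 1, so regularity forces the recursion to start from a
-- finite graph whose own root probability x₀ has no usable closed form. The convergence argument
-- must therefore work from every start, and the only available fact is x₀ ≠ x₁: counts of matchings
-- make x₀ rational, and the fixed point is not. Repulsion is used in quantitative form. For
-- consecutive values x, x + D, z with D ≥ 0, z is at most x / (1 + D) as long as c x stays above a
-- bound B that depends only on k. The gap does not shrink from one pair of steps to the next, so c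
-- x eventually falls below B. Closing the root with d = c + 1 edges over these two graphs gives
-- root probabilities near 1/(d + 1) and 1 - 1/d^(k-2); H is the disjoint union of the two results.

-- Edge lists: matching counts, degrees, linearity, and the tree-like construction.

module Graphs where

  open import Data.Nat using (ℕ; zero; suc; _+_; _*_; _^_; _≤_; z≤n)
  open import Data.Nat.Properties
  open import Data.Nat.Solver using (module +-*-Solver)
  open import Data.Bool using (if_then_else_)
  open import Data.Fin using (zero)
  open import Data.Fin.Subset using (Subset; _∩_; _∪_; ∣_∣; ⊥; ⊤; ⁅_⁆; inside; outside)
  open import Data.Fin.Subset.Properties
    using (∣⊥∣≡0; ∣⁅x⁆∣≡1; ∣p∩q∣≤∣q∣; ∩-zeroʳ; ∩-zeroˡ; ∪-identityʳ; ∪-identityˡ; ∩-idem; ∩-comm)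
  open import Data.Vec using (Vec; []; _∷_; _++_; replicate; zipWith; map)
  open import Data.Vec.Properties
    using (zipWith-++; map-++; zipWith-identityˡ; zipWith-identityʳ; zipWith-assoc; zipWith-replicate; map-replicate)
  open import Data.List as List using (List; []; _∷_; length)
  open import Data.List.Properties using (length-map; map-id)
  open import Data.List.Relation.Unary.All as All using (All; []; _∷_)
  import Data.List.Relation.Unary.All.Properties as All
  open import Data.List.Relation.Unary.AllPairs as AllPairs using (AllPairs; []; _∷_)
  import Data.List.Relation.Unary.AllPairs.Properties as AllPairs
  open import Data.Product using (_×_; _,_)
  open import Function using (const; id)
  open import Relation.Binary.PropositionalEquality

  private variable
    a b n n′ : ℕ

  Edges : ℕ → Set
  Edges n = List (Subset n)

  unless : ℕ → ℕ → ℕ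
  unless zero    x = x
  unless (suc _) _ = 0

  -- the number of matchings none of whose edges meets X
  #avoiding : Edges n → Subset n → ℕ
  #avoiding []       X = 1
  #avoiding (e ∷ es) X = #avoiding es X + unless (∣ e ∩ X ∣) (#avoiding es (e ∪ X))

  indicator : Subset n → Vec ℕ n
  indicator = map (λ s → if s then 1 else 0)

  degrees : Edges n → Vec ℕ n
  degrees {n} []  = replicate n 0
  degrees (e ∷ es) = zipWith _+_ (indicator e) (degrees es)

  Thin : Subset n → Edges n → Set
  Thin X = All (λ e → ∣ X ∩ e ∣ ≤ 1)

  LinearUniform : ℕ → Edges n → Set
  LinearUniform k es = All (λ e → ∣ e ∣ ≡ k) es × AllPairs (λ e f → ∣ e ∩ f ∣ ≤ 1) es

  _⊎ᴱ_ : Edges a → Edges b → Edges (a + b)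
  A ⊎ᴱ B = List.map (_++ ⊥) A List.++ List.map (⊥ ++_) B

  -- Polymorphic because it acts on vertex sets, where `repeat j ⁅ v ⁆` is the edge through the j
  -- copies of v, and also on degree vectors.
  repeat : ∀ {ℓ} {X : Set ℓ} j → Vec X n → Vec X (j * n)
  repeat zero    x = []
  repeat (suc j) x = x ++ repeat j x

  copies : ∀ j → Edges n → Edges (j * n)
  copies zero    A = []
  copies (suc j) A = A ⊎ᴱ copies j A

  ∣++∣ : (p : Subset a) (q : Subset b) → ∣ p ++ q ∣ ≡ ∣ p ∣ + ∣ q ∣
  ∣++∣ []            q = refl
  ∣++∣ (inside  ∷ p) q = cong suc (∣++∣ p q)
  ∣++∣ (outside ∷ p) q = ∣++∣ p q

  ∣++∩++∣ : (p q : Subset a) (r s : Subset b) →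
            ∣ (p ++ r) ∩ (q ++ s) ∣ ≡ ∣ p ∩ q ∣ + ∣ r ∩ s ∣
  ∣++∩++∣ p q r s = trans (cong ∣_∣ (zipWith-++ _ p r q s)) (∣++∣ (p ∩ q) (r ∩ s))

  ∣repeat∣ : ∀ j (p : Subset n) → ∣ repeat j p ∣ ≡ j * ∣ p ∣
  ∣repeat∣ zero    p = refl
  ∣repeat∣ (suc j) p = trans (∣++∣ p _) (cong (∣ p ∣ +_) (∣repeat∣ j p))

  zipWith-repeat : ∀ {ℓ} {X Y Z : Set ℓ} (f : X → Y → Z) j (p : Vec X n) (q : Vec Y n) →
                   zipWith f (repeat j p) (repeat j q) ≡ repeat j (zipWith f p q)
  zipWith-repeat f zero    p q = refl
  zipWith-repeat f (suc j) p q =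
    trans (zipWith-++ f p _ q _) (cong (zipWith f p q ++_) (zipWith-repeat f j p q))

  ∣repeat∩repeat∣ : ∀ j (p q : Subset n) → ∣ repeat j p ∩ repeat j q ∣ ≡ j * ∣ p ∩ q ∣
  ∣repeat∩repeat∣ j p q = trans (cong ∣_∣ (zipWith-repeat _ j p q)) (∣repeat∣ j (p ∩ q))

  replicate-++ : ∀ {ℓ} {X : Set ℓ} a b (x : X) → replicate a x ++ replicate b x ≡ replicate (a + b) x
  replicate-++ zero    b x = refl
  replicate-++ (suc a) b x = cong (x ∷_) (replicate-++ a b x)

  repeat-replicate : ∀ {ℓ} {X : Set ℓ} j n (x : X) → repeat j (replicate n x) ≡ replicate (j * n) x
  repeat-replicate zero    n x = refl
  repeat-replicate (suc j) n x =
    trans (cong (replicate n x ++_) (repeat-replicate j n x)) (replicate-++ n (j * n) x)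

  ∣p∩⊥∣≡0 : (p : Subset n) → ∣ p ∩ ⊥ ∣ ≡ 0
  ∣p∩⊥∣≡0 {n} p = trans (cong ∣_∣ (∩-zeroʳ p)) (∣⊥∣≡0 n)

  ∣⊥∩p∣≡0 : (p : Subset n) → ∣ ⊥ ∩ p ∣ ≡ 0
  ∣⊥∩p∣≡0 {n} p = trans (cong ∣_∣ (∩-zeroˡ p)) (∣⊥∣≡0 n)

  -- Counting matchings

  private
    unless-* : ∀ g x y → unless g (x * y) ≡ unless g x * y
    unless-* zero    x y = refl
    unless-* (suc g) x y = refl

    #avoiding-⊥++ : (B : Edges b) (X : Subset a) (Y : Subset b) →
                    #avoiding (List.map (⊥ ++_) B) (X ++ Y) ≡ #avoiding B Y
    #avoiding-⊥++ []      X Y = refl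
    #avoiding-⊥++ (f ∷ B) X Y = cong₂ _+_ (#avoiding-⊥++ B X Y)
      (cong₂ unless
        (trans (∣++∩++∣ ⊥ X f Y) (cong (_+ ∣ f ∩ Y ∣) (∣⊥∩p∣≡0 X)))
        (trans (cong (#avoiding (List.map (⊥ ++_) B))
                 (trans (zipWith-++ _ ⊥ f X Y) (cong (_++ (f ∪ Y)) (∪-identityˡ X))))
               (#avoiding-⊥++ B X (f ∪ Y))))

  #avoiding-⊎ : (A : Edges a) (B : Edges b) (X : Subset a) (Y : Subset b) →
                #avoiding (A ⊎ᴱ B) (X ++ Y) ≡ #avoiding A X * #avoiding B Y
  #avoiding-⊎ []      B X Y = trans (#avoiding-⊥++ B X Y) (sym (+-identityʳ _))
  #avoiding-⊎ (e ∷ A) B X Y = begin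
    #avoiding (A ⊎ᴱ B) (X ++ Y) + unless (∣ (e ++ ⊥) ∩ (X ++ Y) ∣) (#avoiding (A ⊎ᴱ B) ((e ++ ⊥) ∪ (X ++ Y)))
      ≡⟨ cong₂ _+_ (#avoiding-⊎ A B X Y) (cong₂ unless
           (trans (∣++∩++∣ e X ⊥ Y) (trans (cong (∣ e ∩ X ∣ +_) (∣⊥∩p∣≡0 Y)) (+-identityʳ _)))
           (trans (cong (#avoiding (A ⊎ᴱ B))
                    (trans (zipWith-++ _ e ⊥ X Y) (cong ((e ∪ X) ++_) (∪-identityˡ Y))))
                  (#avoiding-⊎ A B (e ∪ X) Y))) ⟩
    #avoiding A X * #avoiding B Y + unless (∣ e ∩ X ∣) (#avoiding A (e ∪ X) * #avoiding B Y)
      ≡⟨ cong (#avoiding A X * #avoiding B Y +_) (unless-* (∣ e ∩ X ∣) _ _) ⟩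
    #avoiding A X * #avoiding B Y + unless (∣ e ∩ X ∣) (#avoiding A (e ∪ X)) * #avoiding B Y
      ≡⟨ *-distribʳ-+ (#avoiding B Y) (#avoiding A X) _ ⟨
    (#avoiding A X + unless (∣ e ∩ X ∣) (#avoiding A (e ∪ X))) * #avoiding B Y ∎
    where open ≡-Reasoning

  #avoiding-copies : ∀ j (A : Edges n) X → #avoiding (copies j A) (repeat j X) ≡ #avoiding A X ^ j
  #avoiding-copies zero    A X = refl
  #avoiding-copies (suc j) A X =
    trans (#avoiding-⊎ A (copies j A) X (repeat j X)) (cong (#avoiding A X *_) (#avoiding-copies j A X))

  #avoiding-copies-⊥ : ∀ j (A : Edges n) → #avoiding (copies j A) ⊥ ≡ #avoiding A ⊥ ^ j
  #avoiding-copies-⊥ {n} j A =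
    trans (cong (#avoiding (copies j A)) (sym (repeat-replicate j n outside))) (#avoiding-copies j A ⊥)

  #avoiding>0 : (A : Edges n) (X : Subset n) → 1 ≤ #avoiding A X
  #avoiding>0 []      X = ≤-refl
  #avoiding>0 (e ∷ A) X = ≤-trans (#avoiding>0 A X) (m≤m+n _ _)

  -- Degrees

  private
    +ᵛ-assoc : (p q r : Vec ℕ n) → zipWith _+_ (zipWith _+_ p q) r ≡ zipWith _+_ p (zipWith _+_ q r)
    +ᵛ-assoc = zipWith-assoc +-assoc

    0+ᵛ_ : (p : Vec ℕ n) → zipWith _+_ (replicate n 0) p ≡ p
    0+ᵛ p = zipWith-identityˡ {f = _+_} +-identityˡ p

    _+ᵛ0 : (p : Vec ℕ n) → zipWith _+_ p (replicate n 0) ≡ p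
    p +ᵛ0 = zipWith-identityʳ {f = _+_} +-identityʳ p

    indicator-⊥ : ∀ n → indicator (⊥ {n}) ≡ replicate n 0
    indicator-⊥ n = map-replicate _ outside n

  degrees-++ : (A B : Edges n) → degrees (A List.++ B) ≡ zipWith _+_ (degrees A) (degrees B)
  degrees-++ []      B = sym (0+ᵛ _)
  degrees-++ (e ∷ A) B = trans (cong (zipWith _+_ (indicator e)) (degrees-++ A B)) (sym (+ᵛ-assoc _ _ _))

  degrees-map-++ : ∀ {ℓ} {S : Set ℓ} (p : S → Subset a) (q : S → Subset b) L →
                   degrees (List.map (λ s → p s ++ q s) L) ≡ degrees (List.map p L) ++ degrees (List.map q L)
  degrees-map-++ {a = a} {b} p q []      = sym (replicate-++ a b 0)
  degrees-map-++ p q (s ∷ L) =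
    trans (cong₂ (zipWith _+_) (map-++ _ (p s) (q s)) (degrees-map-++ p q L))
          (zipWith-++ _+_ (indicator (p s)) _ (degrees (List.map p L)) _)

  degrees-const-⊥ : ∀ {ℓ} {S : Set ℓ} (L : List S) → degrees (List.map (const ⊥) L) ≡ replicate n 0
  degrees-const-⊥         []      = refl
  degrees-const-⊥ {n = n} (_ ∷ L) =
    trans (cong₂ (zipWith _+_) (indicator-⊥ n) (degrees-const-⊥ L)) (zipWith-replicate _+_ 0 0)

  degrees-⊎ : (A : Edges a) (B : Edges b) → degrees (A ⊎ᴱ B) ≡ degrees A ++ degrees B
  degrees-⊎ {a} {b} A B = begin
    degrees (A ⊎ᴱ B)
      ≡⟨ degrees-++ (List.map (_++ ⊥) A) _ ⟩
    zipWith _+_ (degrees (List.map (_++ ⊥) A)) (degrees (List.map (⊥ ++_) B))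
      ≡⟨ cong₂ (zipWith _+_) (degrees-map-++ id (const ⊥) A) (degrees-map-++ (const ⊥) id B) ⟩
    zipWith _+_ (degrees (List.map id A) ++ degrees (List.map (const ⊥) A))
                (degrees (List.map (const ⊥) B) ++ degrees (List.map id B))
      ≡⟨ cong₂ (zipWith _+_) (cong₂ _++_ (cong degrees (map-id A)) (degrees-const-⊥ A))
                             (cong₂ _++_ (degrees-const-⊥ B) (cong degrees (map-id B))) ⟩
    zipWith _+_ (degrees A ++ replicate b 0) (replicate a 0 ++ degrees B)
      ≡⟨ zipWith-++ _+_ (degrees A) _ (replicate a 0) _ ⟩
    zipWith _+_ (degrees A) (replicate a 0) ++ zipWith _+_ (replicate b 0) (degrees B)
      ≡⟨ cong₂ _++_ (degrees A +ᵛ0) (0+ᵛ degrees B) ⟩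
    degrees A ++ degrees B ∎
    where open ≡-Reasoning

  degrees-copies : ∀ j (A : Edges n) → degrees (copies j A) ≡ repeat j (degrees A)
  degrees-copies zero    A = refl
  degrees-copies (suc j) A = trans (degrees-⊎ A (copies j A)) (cong (degrees A ++_) (degrees-copies j A))

  degrees-repeat : ∀ j (L : Edges n) → degrees (List.map (repeat j) L) ≡ repeat j (degrees L)
  degrees-repeat zero    L = go L
    where
    go : ∀ L → degrees (List.map (repeat 0) L) ≡ []
    go []      = refl
    go (_ ∷ L) rewrite go L = refl
  degrees-repeat (suc j) L =
    trans (degrees-map-++ id (repeat j) L)
          (cong₂ _++_ (cong degrees (map-id L)) (degrees-repeat j L))

  -- Linearity

  Thin-⊎ : ∀ (X : Subset a) (Y : Subset b) {A B} → Thin X A → Thin Y B → Thin (X ++ Y) (A ⊎ᴱ B)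
  Thin-⊎ X Y tA tB = All.++⁺
    (All.map⁺ (All.map (λ {e} t → subst (_≤ 1) (sym (trans (∣++∩++∣ X e Y ⊥)
       (trans (cong (∣ X ∩ e ∣ +_) (∣p∩⊥∣≡0 Y)) (+-identityʳ _)))) t) tA))
    (All.map⁺ (All.map (λ {f} t → subst (_≤ 1) (sym (trans (∣++∩++∣ X ⊥ Y f)
       (cong (_+ ∣ Y ∩ f ∣) (∣p∩⊥∣≡0 X)))) t) tB))

  Thin-copies : ∀ j (X : Subset n) {A} → Thin X A → Thin (repeat j X) (copies j A)
  Thin-copies zero    X t = []
  Thin-copies (suc j) X t = Thin-⊎ X (repeat j X) t (Thin-copies j X t)

  singleton-Thin : (X : Subset n) → ∣ X ∣ ≡ 1 → (A : Edges n) → Thin X A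
  singleton-Thin X ∣X∣≡1 A =
    All.universal (λ e → ≤-trans (≤-trans (≤-reflexive (cong ∣_∣ (∩-comm X e))) (∣p∩q∣≤∣q∣ e X)) (≤-reflexive ∣X∣≡1)) A

  LinearUniform-⊎ : ∀ {k} {A : Edges a} {B : Edges b} →
                    LinearUniform k A → LinearUniform k B → LinearUniform k (A ⊎ᴱ B)
  LinearUniform-⊎ {a} {b} {A = A} {B} (uA , lA) (uB , lB) =
    All.++⁺ (All.map⁺ (All.map (λ {e} u → trans (∣++∣ e (⊥ {b})) (trans (cong (∣ e ∣ +_) (∣⊥∣≡0 b)) (trans (+-identityʳ _) u))) uA))
            (All.map⁺ (All.map (λ {f} u → trans (∣++∣ (⊥ {a}) f) (trans (cong (_+ ∣ f ∣) (∣⊥∣≡0 a)) u)) uB)) ,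
    AllPairs.++⁺
      (AllPairs.map⁺ (AllPairs.map (λ {e} {f} t → subst (_≤ 1) (sym (trans (∣++∩++∣ e f (⊥ {b}) ⊥)
         (trans (cong (∣ e ∩ f ∣ +_) (∣p∩⊥∣≡0 (⊥ {b}))) (+-identityʳ _)))) t) lA))
      (AllPairs.map⁺ (AllPairs.map (λ {e} {f} t → subst (_≤ 1) (sym (trans (∣++∩++∣ (⊥ {a}) ⊥ e f)
         (cong (_+ ∣ e ∩ f ∣) (∣p∩⊥∣≡0 (⊥ {a}))))) t) lB))
      (All.map⁺ (All.universal (λ e → All.map⁺ (All.universal (λ f → subst (_≤ 1)
         (sym (trans (∣++∩++∣ e ⊥ ⊥ f) (cong₂ _+_ (∣p∩⊥∣≡0 e) (∣⊥∩p∣≡0 f)))) z≤n) B)) A))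

  LinearUniform-copies : ∀ j {k} {A : Edges n} → LinearUniform k A → LinearUniform k (copies j A)
  LinearUniform-copies zero    lu = [] , []
  LinearUniform-copies (suc j) lu = LinearUniform-⊎ lu (LinearUniform-copies j lu)

  LinearUniform-++ : ∀ {k} {L A : Edges n} → LinearUniform k L → LinearUniform k A →
                     All (λ X → Thin X A) L → LinearUniform k (L List.++ A)
  LinearUniform-++ (uL , lL) (uA , lA) t = All.++⁺ uL uA , AllPairs.++⁺ lL lA t

  -- Attaching copies of a graph to a root

  -- Vertices of D are kept as one-element subsets: `repeat m` then turns them into edges across m
  -- copies, and `degrees` of the list is the indicator of D.
  singletons : Subset n → Edges n
  singletons []            = []
  singletons (inside  ∷ D) = ⁅ zero ⁆ ∷ List.map (outside ∷_) (singletons D)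
  singletons (outside ∷ D) = List.map (outside ∷_) (singletons D)

  private
    degrees-outside : (L : Edges n) → degrees (List.map (outside ∷_) L) ≡ 0 ∷ degrees L
    degrees-outside []      = refl
    degrees-outside (s ∷ L) = cong (zipWith _+_ (0 ∷ indicator s)) (degrees-outside L)

  degrees-singletons : (D : Subset n) → degrees (singletons D) ≡ indicator D
  degrees-singletons [] = refl
  degrees-singletons {suc n} (inside ∷ D) =
    trans (cong (zipWith _+_ (1 ∷ indicator ⊥)) (degrees-outside (singletons D)))
          (cong (1 ∷_) (trans (cong₂ (zipWith _+_) (indicator-⊥ n) (degrees-singletons D))
                              (0+ᵛ _)))
  degrees-singletons (outside ∷ D) = trans (degrees-outside (singletons D)) (cong (0 ∷_) (degrees-singletons D))

  length-singletons : (D : Subset n) → length (singletons D) ≡ ∣ D ∣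
  length-singletons []            = refl
  length-singletons (inside  ∷ D) = cong suc (trans (length-map _ (singletons D)) (length-singletons D))
  length-singletons (outside ∷ D) = trans (length-map _ (singletons D)) (length-singletons D)

  singletons-size : (D : Subset n) → All (λ s → ∣ s ∣ ≡ 1) (singletons D)
  singletons-size []                    = []
  singletons-size {suc n} (inside  ∷ D) = cong suc (∣⊥∣≡0 n) ∷ All.map⁺ (singletons-size D)
  singletons-size (outside ∷ D)         = All.map⁺ (singletons-size D)

  singletons-disjoint : (D : Subset n) → AllPairs (λ s t → ∣ s ∩ t ∣ ≡ 0) (singletons D)
  singletons-disjoint []            = []
  singletons-disjoint (inside  ∷ D) =
    All.map⁺ (All.universal ∣⊥∩p∣≡0 (singletons D)) ∷ AllPairs.map⁺ (singletons-disjoint D)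
  singletons-disjoint (outside ∷ D) = AllPairs.map⁺ (singletons-disjoint D)

  singletons-⊥ : ∀ n → singletons (⊥ {n}) ≡ []
  singletons-⊥ zero    = refl
  singletons-⊥ (suc n) = cong (List.map (outside ∷_)) (singletons-⊥ n)

  root : Subset (suc n)
  root = ⁅ zero ⁆

  ∣root∣≡1 : ∣ root {n} ∣ ≡ 1
  ∣root∣≡1 {n} = ∣⁅x⁆∣≡1 {suc n} zero

  module _ (m : ℕ) where

    -- One edge for each vertex v of D, through the root of the left part and the m copies of v on
    -- the right.
    spokes : ∀ n → Subset n′ → Edges (suc n + m * n′)
    spokes n D = List.map (λ s → root ++ repeat m s) (singletons D)

    attach : Edges (suc n) → Edges n′ → Subset n′ → Edges (suc n + m * n′)
    attach {n} A F D = spokes n D List.++ (A ⊎ᴱ copies m F)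

    -- Two spokes share only the root. An old edge lies in one component, which a spoke meets in a
    -- single vertex.
    attach-LinearUniform : ∀ {A : Edges (suc n)} {F : Edges n′} D →
      LinearUniform (suc m) A → LinearUniform (suc m) F → LinearUniform (suc m) (attach A F D)
    attach-LinearUniform {n} {n′} {A} {F} D luA luF = LinearUniform-++
      ( All.map⁺ (All.map (λ {s} eq → trans (∣++∣ (root {n}) (repeat m s))
          (cong₂ _+_ (∣root∣≡1 {n}) (trans (∣repeat∣ m s) (trans (cong (m *_) eq) (*-identityʳ m))))) (singletons-size D))
      , AllPairs.map⁺ (AllPairs.map (λ {s} {t} eq → ≤-reflexive (trans (∣++∩++∣ (root {n}) root (repeat m s) (repeat m t))
          (cong₂ _+_ (trans (cong ∣_∣ (∩-idem (root {n}))) (∣root∣≡1 {n}))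
                     (trans (∣repeat∩repeat∣ m s t) (trans (cong (m *_) eq) (*-zeroʳ m)))))) (singletons-disjoint D)) )
      (LinearUniform-⊎ luA (LinearUniform-copies m luF))
      (All.map⁺ (All.map (λ {s} eq → Thin-⊎ root (repeat m s) (singleton-Thin root (∣root∣≡1 {n}) A) (Thin-copies m s (singleton-Thin s eq F))) (singletons-size D)))

    private
      degrees-const-root : ∀ {ℓ} {S : Set ℓ} (L : List S) →
                           degrees (List.map (const (root {n})) L) ≡ length L ∷ replicate n 0
      degrees-const-root         []      = refl
      degrees-const-root {n = n} (_ ∷ L) = trans (cong (zipWith _+_ (1 ∷ indicator ⊥)) (degrees-const-root L))
        (cong (suc (length L) ∷_) (trans (cong (λ z → zipWith _+_ z (replicate n 0)) (indicator-⊥ n)) (zipWith-replicate _+_ 0 0)))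

    -- The hypothesis on D says that D consists exactly of the vertices of F that lack one edge;
    -- each copy of such a vertex receives one spoke.
    attach-degrees : ∀ {A : Edges (suc n)} {F : Edges n′} D {j d} →
      degrees A ≡ j ∷ replicate n d → zipWith _+_ (indicator D) (degrees F) ≡ replicate n′ d →
      degrees (attach A F D) ≡ (∣ D ∣ + j) ∷ replicate (n + m * n′) d
    attach-degrees {n} {n′} {A} {F} D {j} {d} degA degF = begin
      degrees (attach A F D)
        ≡⟨ degrees-++ (spokes n D) _ ⟩
      zipWith _+_ (degrees (spokes n D)) (degrees (A ⊎ᴱ copies m F))
        ≡⟨ cong₂ (zipWith _+_)
             (trans (degrees-map-++ (const root) (repeat m) (singletons D))
               (cong₂ _++_ (trans (degrees-const-root (singletons D)) (cong (_∷ replicate n 0) (length-singletons D)))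
                           (trans (degrees-repeat m (singletons D)) (cong (repeat m) (degrees-singletons D)))))
             (trans (degrees-⊎ A (copies m F)) (cong₂ _++_ degA (degrees-copies m F))) ⟩
      zipWith _+_ ((∣ D ∣ ∷ replicate n 0) ++ repeat m (indicator D)) ((j ∷ replicate n d) ++ repeat m (degrees F))
        ≡⟨ zipWith-++ _+_ (∣ D ∣ ∷ replicate n 0) _ (j ∷ replicate n d) _ ⟩
      (∣ D ∣ + j) ∷ (zipWith _+_ (replicate n 0) (replicate n d) ++ zipWith _+_ (repeat m (indicator D)) (repeat m (degrees F)))
        ≡⟨ cong ((∣ D ∣ + j) ∷_) (cong₂ _++_ (zipWith-replicate _+_ 0 d)
             (trans (zipWith-repeat _+_ m _ _) (trans (cong (repeat m) degF) (repeat-replicate m n′ d)))) ⟩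
      (∣ D ∣ + j) ∷ (replicate n d ++ replicate (m * n′) d)
        ≡⟨ cong ((∣ D ∣ + j) ∷_) (replicate-++ n _ d) ⟩
      (∣ D ∣ + j) ∷ replicate (n + m * n′) d ∎
      where open ≡-Reasoning

    -- In fan j F D the root has j ∣D∣ edges: for each of j rounds, m fresh copies of F
    -- are taken, and every vertex in D yields an edge through its m copies and the root.
    fanSize : ℕ → ℕ → ℕ
    fanSize n′ zero    = 0
    fanSize n′ (suc j) = fanSize n′ j + m * n′

    fan : ∀ j → Edges n′ → Subset n′ → Edges (suc (fanSize n′ j))
    fan zero    F D = []
    fan (suc j) F D = attach (fan j F D) F D

    fan-LinearUniform : ∀ j {F : Edges n′} D → LinearUniform (suc m) F → LinearUniform (suc m) (fan j F D)
    fan-LinearUniform zero    D lu = [] , []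
    fan-LinearUniform (suc j) D lu = attach-LinearUniform D (fan-LinearUniform j D lu) lu

    fan-degrees : ∀ j {F : Edges n′} D {d} → zipWith _+_ (indicator D) (degrees F) ≡ replicate n′ d →
                  degrees (fan j F D) ≡ j * ∣ D ∣ ∷ replicate (fanSize n′ j) d
    fan-degrees zero    D degF = refl
    fan-degrees (suc j) D degF = attach-degrees {A = fan j _ D} D (fan-degrees j D degF) degF

    -- The single spoke contains the forbidden root, so it drops out and leaves the m copies
    -- unrestricted.
    attach-uncovered : (A : Edges (suc n)) (F : Edges (suc n′)) →
      #avoiding (attach A F root) root ≡ #avoiding A root * #avoiding F ⊥ ^ m
    attach-uncovered {n} {n′} A F
      rewrite singletons-⊥ n′ = trans (+-identityʳ _)
      (trans (cong (#avoiding (A ⊎ᴱ copies m F)) (cong (inside ∷_) (sym (replicate-++ n _ outside))))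
      (trans (#avoiding-⊎ A (copies m F) root ⊥) (cong (#avoiding A root *_) (#avoiding-copies-⊥ m F))))

    -- The two summands are the matchings without and with the spoke. Using it blocks the root of A
    -- and the roots of all m copies at once, whence the m-th power.
    attach-total : (A : Edges (suc n)) (F : Edges (suc n′)) →
      #avoiding (attach A F root) ⊥ ≡
      #avoiding A ⊥ * #avoiding F ⊥ ^ m + #avoiding A root * #avoiding F root ^ m
    attach-total {n} {n′} A F
      rewrite singletons-⊥ n′ = cong₂ _+_
      (trans (cong (#avoiding (A ⊎ᴱ copies m F)) (sym (replicate-++ (suc n) _ outside)))
      (trans (#avoiding-⊎ A (copies m F) ⊥ ⊥) (cong (#avoiding A ⊥ *_) (#avoiding-copies-⊥ m F))))
      (trans (cong₂ unless (∣p∩⊥∣≡0 ((root {n}) ++ repeat m (root {n′}))) (cong (#avoiding (A ⊎ᴱ copies m F)) (∪-identityʳ _)))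
      (trans (#avoiding-⊎ A (copies m F) root (repeat m root)) (cong (#avoiding A root *_) (#avoiding-copies m F root))))

    -- With denominators cleared, this is the map x ↦ 1 / (1 + j xᵐ) for x = U / Z: every further
    -- spoke adds the same term xᵐ to the ratio of total to uncovered.
    fan-count : ∀ j (F : Edges (suc n)) → let U = #avoiding F root ; Z = #avoiding F ⊥ in
      #avoiding (fan j F root) ⊥ * Z ^ m ≡ #avoiding (fan j F root) root * (Z ^ m + j * U ^ m)
    fan-count zero    F = cong (1 *_) (sym (+-identityʳ _))
    fan-count (suc j) F = begin
      #avoiding (fan (suc j) F root) ⊥ * Zᵐ
        ≡⟨ cong (_* Zᵐ) (attach-total (fan j F root) F) ⟩
      (Zⱼ * Zᵐ + Uⱼ * Uᵐ) * Zᵐ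
        ≡⟨ cong (λ z → (z + Uⱼ * Uᵐ) * Zᵐ) (fan-count j F) ⟩
      (Uⱼ * (Zᵐ + j * Uᵐ) + Uⱼ * Uᵐ) * Zᵐ
        ≡⟨ solve 4 (λ u v z j → (u :* (z :+ j :* v) :+ u :* v) :* z := (u :* z) :* (z :+ (con 1 :+ j) :* v)) refl Uⱼ Uᵐ Zᵐ j ⟩
      (Uⱼ * Zᵐ) * (Zᵐ + suc j * Uᵐ)
        ≡⟨ cong (_* (Zᵐ + suc j * Uᵐ)) (sym (attach-uncovered (fan j F root) F)) ⟩
      #avoiding (fan (suc j) F root) root * (Zᵐ + suc j * Uᵐ) ∎
      where
      open ≡-Reasoning
      open +-*-Solver
      Uᵐ Zᵐ Uⱼ Zⱼ : ℕ
      Uᵐ = #avoiding F root ^ m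
      Zᵐ = #avoiding F ⊥ ^ m
      Uⱼ = #avoiding (fan j F root) root
      Zⱼ = #avoiding (fan j F root) ⊥

    -- Gadgets

    -- The root lacks exactly one edge, which the spoke above it supplies; only the topmost root is
    -- ever deficient.
    record Gadget (c : ℕ) : Set where
      field
        {others}      : ℕ
        edges         : Edges (suc others)
        linearUniform : LinearUniform (suc m) edges
        degrees≡      : degrees edges ≡ c ∷ replicate others (suc c)

    open Gadget public

    gadget-completes : ∀ {c} (G : Gadget c) →
      zipWith _+_ (indicator root) (degrees (edges G)) ≡ replicate (suc (others G)) (suc c)
    gadget-completes {c} G = trans (cong (zipWith _+_ (indicator root)) (degrees≡ G))
      (cong (suc c ∷_) (trans (cong (λ z → zipWith _+_ z (replicate (others G) (suc c))) (indicator-⊥ (others G))) (zipWith-replicate _+_ 0 (suc c))))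

    fan-gadget-degrees : ∀ j {c} (G : Gadget c) →
      degrees (fan j (edges G) root) ≡ j ∷ replicate (fanSize (suc (others G)) j) (suc c)
    fan-gadget-degrees j {c} G = trans (fan-degrees j root (gadget-completes G))
      (cong (_∷ replicate (fanSize (suc (others G)) j) (suc c)) (trans (cong (j *_) (∣root∣≡1 {others G})) (*-identityʳ j)))

    next : ∀ {c} → Gadget c → Gadget c
    next {c} G = record
      { edges         = fan c (edges G) root
      ; linearUniform = fan-LinearUniform c root (linearUniform G)
      ; degrees≡      = fan-gadget-degrees c G
      }

    record RegularGraph (d : ℕ) : Set where
      field
        {others}      : ℕ
        edges         : Edges (suc others)
        linearUniform : LinearUniform (suc m) edges
        degrees≡      : degrees edges ≡ replicate (suc others) d

    cap : ∀ {c} → Gadget c → RegularGraph (suc c)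
    cap {c} G = record
      { edges         = fan (suc c) (edges G) root
      ; linearUniform = fan-LinearUniform (suc c) root (linearUniform G)
      ; degrees≡      = fan-gadget-degrees (suc c) G
      }

    -- The edges are the axis-parallel lines of the grid (Fin (suc m)) ^ d.
    grid : ∀ d → RegularGraph d
    grid zero    = record { edges = [] {A = Subset 1} ; linearUniform = [] , [] ; degrees≡ = refl }
    grid (suc d) = record
      { edges         = lines List.++ copies (suc m) A
      ; linearUniform = LinearUniform-++
          ( All.map⁺ {f = repeat (suc m)} (All.map (λ {s} eq → trans (∣repeat∣ (suc m) s) (trans (cong (suc m *_) eq) (*-identityʳ (suc m)))) (singletons-size V))
          , AllPairs.map⁺ {f = repeat (suc m)} (AllPairs.map (λ {s} {t} eq → ≤-trans (≤-reflexive (trans (∣repeat∩repeat∣ (suc m) s t)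
              (trans (cong (suc m *_) eq) (*-zeroʳ (suc m))))) z≤n) (singletons-disjoint V)) )
          (LinearUniform-copies (suc m) R.linearUniform)
          (All.map⁺ {f = repeat (suc m)} (All.map (λ {s} eq → Thin-copies (suc m) s (singleton-Thin s eq A)) (singletons-size V)))
      ; degrees≡      = trans (degrees-++ lines (copies (suc m) A))
          (trans (cong₂ (zipWith _+_)
            (trans (degrees-repeat (suc m) (singletons V)) (trans (cong (repeat (suc m))
               (trans (degrees-singletons V) (map-replicate _ inside (suc R.others)))) (repeat-replicate (suc m) (suc R.others) 1)))
            (trans (degrees-copies (suc m) A) (trans (cong (repeat (suc m)) R.degrees≡) (repeat-replicate (suc m) (suc R.others) d))))
          (zipWith-replicate _+_ 1 d))
      }
      where
      module R = RegularGraph (grid d)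
      A : Edges (suc R.others)
      A = R.edges
      V : Subset (suc R.others)
      V = ⊤
      lines : Edges (suc m * suc R.others)
      lines = List.map (repeat (suc m)) (singletons V)

    -- Removing one edge from a regular graph leaves suc m vertices of deficient
    -- degree, which a fan then absorbs; this is where c must be divisible by suc m.
    initialGadget : ∀ t → Gadget (t * suc m)
    initialGadget t = build R.edges R.linearUniform R.degrees≡
      where
      module R = RegularGraph (grid (suc (t * suc m)))
      build : (es : Edges (suc n)) → LinearUniform (suc m) es →
              degrees es ≡ replicate (suc n) (suc (t * suc m)) → Gadget (t * suc m)
      build []       _                       ()
      build (e ∷ es) (∣e∣≡k ∷ u , _ ∷ l) deg = record
        { edges         = fan t es e
        ; linearUniform = fan-LinearUniform t e (u , l)
        ; degrees≡      = trans (fan-degrees t e deg) (cong (λ k → t * k ∷ _) ∣e∣≡k)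
        }

-- Agreement of edge lists with the hypergraph definitions.

module Hypergraphs where

  open Graphs
  open import Defs hiding (n; m)
  open import Data.Nat using (ℕ; zero; suc; _+_; _≤_)
  open import Data.Nat.Properties using (1+n≢0)
  open import Data.Bool using (if_then_else_)
  open import Data.Fin using (Fin; zero; suc)
  open import Data.Fin.Subset using (Subset; _∩_; _∪_; ∣_∣; ⊥; ⁅_⁆; inside; outside; _∈_; Empty)
  open import Data.Fin.Subset.Properties
    using (∣⊥∣≡0; ∩-comm; Empty-unique; x∈p∩q⁺; x∈p∩q⁻; x∈p∪q⁺; x∈p∪q⁻; ∉⊥; x∈⁅x⁆; x∈⁅y⁆⇒x≡y; _∈?_)
  import Data.Vec as Vec
  open import Data.Vec using ([]; _∷_; here; there)
  open import Data.Vec.Properties using ([]=⇒lookup; lookup⇒[]=; lookup-zipWith; lookup-map; lookup-replicate)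
  open import Data.List as List using (List; []; _∷_; length; filter; allFin)
  open import Data.List.Properties
    using (length-++; filter-++; filter-accept; filter-reject; filter-none; map-tabulate)
  open import Data.List.Relation.Unary.All as All using (All; []; _∷_)
  open import Data.List.Relation.Unary.AllPairs using (AllPairs; []; _∷_)
  open import Data.Product using (_×_; _,_; proj₁; proj₂)
  open import Data.Sum using (inj₁; inj₂)
  open import Data.Empty using (⊥-elim)
  open import Function using (_∘_; id)
  open import Relation.Nullary using (Dec; yes; no)
  open import Relation.Nullary.Decidable using (¬?; _×-dec_)
  open import Relation.Unary using (Decidable)
  open import Relation.Binary.PropositionalEquality

  private variable
    k l : ℕ

  hypergraph : Edges l → Hypergraph
  hypergraph {l} es = record { n = l ; m = length es ; edge = List.lookup es }

  -- Counting by filtering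

  private
    length-filter-map : ∀ {X Y : Set} {P : Y → Set} (P? : Decidable P) (f : X → Y) xs →
                        length (filter P? (List.map f xs)) ≡ length (filter (P? ∘ f) xs)
    length-filter-map P? f []       = refl
    length-filter-map P? f (x ∷ xs) with P? (f x)
    ... | yes _ = cong suc (length-filter-map P? f xs)
    ... | no  _ = length-filter-map P? f xs

    length-filter-filter : ∀ {X : Set} {P Q : X → Set} (P? : Decidable P) (Q? : Decidable Q) xs →
                           length (filter Q? (filter P? xs)) ≡ length (filter (λ x → P? x ×-dec Q? x) xs)
    length-filter-filter P? Q? []       = refl
    length-filter-filter P? Q? (x ∷ xs) with P? x
    ... | no  _ = length-filter-filter P? Q? xs
    ... | yes _ with Q? x
    ...   | yes _ = cong suc (length-filter-filter P? Q? xs)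
    ...   | no  _ = length-filter-filter P? Q? xs

    Empty⇒∣∣≡0 : {p : Subset l} → Empty p → ∣ p ∣ ≡ 0
    Empty⇒∣∣≡0 {l} e = trans (cong ∣_∣ (Empty-unique e)) (∣⊥∣≡0 l)

    ∣∣≡0⇒Empty : {p : Subset l} → ∣ p ∣ ≡ 0 → Empty p
    ∣∣≡0⇒Empty {p = outside ∷ p} eq (suc i , there i∈p) = ∣∣≡0⇒Empty eq (i , i∈p)

    Empty-comm : (p q : Subset l) → Empty (p ∩ q) → Empty (q ∩ p)
    Empty-comm p q = subst Empty (∩-comm p q)

    Empty-∩-∪⁺ : (p q r : Subset l) → Empty (p ∩ q) → Empty (p ∩ r) → Empty (p ∩ (q ∪ r))
    Empty-∩-∪⁺ p q r ¬pq ¬pr (i , i∈) with x∈p∩q⁻ p (q ∪ r) i∈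
    ... | i∈p , i∈q∪r with x∈p∪q⁻ q r i∈q∪r
    ...   | inj₁ i∈q = ¬pq (i , x∈p∩q⁺ (i∈p , i∈q))
    ...   | inj₂ i∈r = ¬pr (i , x∈p∩q⁺ (i∈p , i∈r))

    Empty-∩-∪⁻ : (p q r : Subset l) → Empty (p ∩ (q ∪ r)) → Empty (p ∩ q) × Empty (p ∩ r)
    Empty-∩-∪⁻ p q r ¬pqr =
      (λ (i , i∈) → let i∈p , i∈q = x∈p∩q⁻ p q i∈ in ¬pqr (i , x∈p∩q⁺ (i∈p , x∈p∪q⁺ (inj₁ i∈q)))) ,
      (λ (i , i∈) → let i∈p , i∈r = x∈p∩q⁻ p r i∈ in ¬pqr (i , x∈p∩q⁺ (i∈p , x∈p∪q⁺ (inj₂ i∈r))))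

  Avoiding : (es : Edges l) → Subset l → Subset (length es) → Set
  Avoiding es X S = IsMatching (hypergraph es) S × (∀ i → i ∈ S → Empty (List.lookup es i ∩ X))

  private
    outside⁻ : ∀ {e} {es : Edges l} {X S} → Avoiding (e ∷ es) X (outside ∷ S) → Avoiding es X S
    outside⁻ (μ , α) =
      (λ i j i∈ j∈ i≢j → μ (suc i) (suc j) (there i∈) (there j∈) (λ { refl → i≢j refl })) ,
      (λ i i∈ → α (suc i) (there i∈))

    outside⁺ : ∀ {e} {es : Edges l} {X S} → Avoiding es X S → Avoiding (e ∷ es) X (outside ∷ S)
    outside⁺ (μ , α) =
      (λ { (suc i) (suc j) (there i∈) (there j∈) i≢j → μ i j i∈ j∈ (λ i≡j → i≢j (cong suc i≡j)) }) ,
      (λ { (suc i) (there i∈) → α i i∈ })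

    inside⁻ : ∀ {e} {es : Edges l} {X S} → Avoiding (e ∷ es) X (inside ∷ S) → Avoiding es (e ∪ X) S
    inside⁻ {e = e} {es} {X} (μ , α) =
      (λ i j i∈ j∈ i≢j → μ (suc i) (suc j) (there i∈) (there j∈) (λ { refl → i≢j refl })) ,
      (λ i i∈ → Empty-∩-∪⁺ (List.lookup es i) e X (μ (suc i) zero (there i∈) here (λ ())) (α (suc i) (there i∈)))

    inside⁺ : ∀ {e} {es : Edges l} {X S} → Empty (e ∩ X) → Avoiding es (e ∪ X) S → Avoiding (e ∷ es) X (inside ∷ S)
    inside⁺ {e = e} {es} {X} {S} e∩X (μ , α) = μ′ , α′
      where
      μ′ : IsMatching (hypergraph (e ∷ es)) (inside ∷ S)
      μ′ zero    zero    _          _          i≢j = ⊥-elim (i≢j refl)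
      μ′ zero    (suc j) _          (there j∈) _   =
        Empty-comm (List.lookup es j) e (proj₁ (Empty-∩-∪⁻ (List.lookup es j) e X (α j j∈)))
      μ′ (suc i) zero    (there i∈) _          _   = proj₁ (Empty-∩-∪⁻ (List.lookup es i) e X (α i i∈))
      μ′ (suc i) (suc j) (there i∈) (there j∈) i≢j = μ i j i∈ j∈ (λ i≡j → i≢j (cong suc i≡j))
      α′ : ∀ i → i ∈ inside ∷ S → Empty (List.lookup (e ∷ es) i ∩ X)
      α′ zero    _          = e∩X
      α′ (suc i) (there i∈) = proj₂ (Empty-∩-∪⁻ (List.lookup es i) e X (α i i∈))

  -- Choosing e enlarges the forbidden set to `e ∪ X`, so disjointness from e becomes avoidance for
  -- the later edges. Any decidable predicate equivalent to `Avoiding` is allowed: the induction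
  -- needs `P?` composed with `outside ∷_` and `inside ∷_`, and the applications need the deciders
  -- that occur in `Puncov`.
  #avoiding-correct : (es : Edges l) (X : Subset l) {P : Subset (length es) → Set} (P? : Decidable P) →
    (∀ {S} → P S → Avoiding es X S) → (∀ {S} → Avoiding es X S → P S) →
    length (filter P? (allSubsets (length es))) ≡ #avoiding es X
  #avoiding-correct []       X P? P⇒ ⇒P = cong length (filter-accept P? {[]} {[]} (⇒P ((λ ()) , (λ ()))))
  #avoiding-correct (e ∷ es) X {P} P? P⇒ ⇒P = begin
    length (filter P? (List.map (outside ∷_) Ss List.++ List.map (inside ∷_) Ss))
      ≡⟨ cong length (filter-++ P? (List.map (outside ∷_) Ss) _) ⟩
    length (filter P? (List.map (outside ∷_) Ss) List.++ filter P? (List.map (inside ∷_) Ss))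
      ≡⟨ length-++ (filter P? (List.map (outside ∷_) Ss)) ⟩
    length (filter P? (List.map (outside ∷_) Ss)) + length (filter P? (List.map (inside ∷_) Ss))
      ≡⟨ cong₂ _+_ (length-filter-map P? (outside ∷_) Ss) (length-filter-map P? (inside ∷_) Ss) ⟩
    length (filter (P? ∘ (outside ∷_)) Ss) + length (filter (P? ∘ (inside ∷_)) Ss)
      ≡⟨ cong₂ _+_ (#avoiding-correct es X (P? ∘ (outside ∷_)) (outside⁻ ∘ P⇒) (⇒P ∘ outside⁺))
                   (containing ∣ e ∩ X ∣ refl) ⟩
    #avoiding es X + unless (∣ e ∩ X ∣) (#avoiding es (e ∪ X)) ∎
    where
    open ≡-Reasoning
    Ss : List (Subset (length es))
    Ss = allSubsets (length es)
    -- The size is a separate argument so that `unless` reduces once g is split; for positive g no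
    -- admissible set contains e.
    containing : ∀ g → ∣ e ∩ X ∣ ≡ g →
                 length (filter (P? ∘ (inside ∷_)) Ss) ≡ unless g (#avoiding es (e ∪ X))
    containing zero    eq = #avoiding-correct es (e ∪ X) (P? ∘ (inside ∷_)) (inside⁻ ∘ P⇒)
                              (⇒P ∘ inside⁺ (∣∣≡0⇒Empty eq))
    containing (suc g) eq = cong length (filter-none (P? ∘ (inside ∷_))
      (All.universal (λ S p → 1+n≢0 (trans (sym eq) (Empty⇒∣∣≡0 (proj₂ (P⇒ p) zero here)))) Ss))

  #matchings : (es : Edges l) → length (matchings (hypergraph es)) ≡ #avoiding es ⊥
  #matchings es = #avoiding-correct es ⊥ (isMatching? (hypergraph es))
    (λ μ → μ , λ i _ (_ , v∈) → ∉⊥ (proj₂ (x∈p∩q⁻ (List.lookup es i) ⊥ v∈))) proj₁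

  #uncovering : (es : Edges l) (v : Fin l) →
    length (filter (λ S → ¬? (covers? (hypergraph es) S v)) (matchings (hypergraph es))) ≡ #avoiding es ⁅ v ⁆
  #uncovering es v = trans
    (length-filter-filter (isMatching? H) (λ S → ¬? (covers? H S v)) (allSubsets (length es)))
    (#avoiding-correct es ⁅ v ⁆ (λ S → isMatching? H S ×-dec ¬? (covers? H S v))
      (λ (μ , ¬cov) → μ , λ i i∈ (w , w∈) → let w∈e , w∈v = x∈p∩q⁻ (List.lookup es i) ⁅ v ⁆ w∈ in
          ¬cov (i , i∈ , subst (_∈ List.lookup es i) (x∈⁅y⁆⇒x≡y v w∈v) w∈e))
      (λ (μ , α) → μ , λ (i , i∈ , v∈e) → α i i∈ (v , x∈p∩q⁺ (v∈e , x∈⁅x⁆ v))))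
    where H = hypergraph es

  hypergraph-Uniform : ∀ {es : Edges l} → All (λ e → ∣ e ∣ ≡ k) es → Uniform k (hypergraph es)
  hypergraph-Uniform (u ∷ us) zero    = u
  hypergraph-Uniform (u ∷ us) (suc i) = hypergraph-Uniform us i

  private
    lookup-All : ∀ {P : Subset l → Set} {es : Edges l} → All P es → ∀ i → P (List.lookup es i)
    lookup-All (p ∷ ps) zero    = p
    lookup-All (p ∷ ps) (suc i) = lookup-All ps i

  hypergraph-Linear : ∀ {es : Edges l} → AllPairs (λ e f → ∣ e ∩ f ∣ ≤ 1) es → Linear (hypergraph es)
  hypergraph-Linear (p ∷ ps) zero    zero    i≢j = ⊥-elim (i≢j refl)
  hypergraph-Linear (p ∷ ps) zero    (suc j) i≢j = lookup-All p j
  hypergraph-Linear {es = e ∷ es} (p ∷ ps) (suc i) zero i≢j =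
    subst (λ s → ∣ s ∣ ≤ 1) (∩-comm e (List.lookup es i)) (lookup-All p i)
  hypergraph-Linear (p ∷ ps) (suc i) (suc j) i≢j = hypergraph-Linear ps i j (λ i≡j → i≢j (cong suc i≡j))

  degree≡ : (es : Edges l) (v : Fin l) → degree (hypergraph es) v ≡ Vec.lookup (degrees es) v
  degree≡ []       v = sym (lookup-replicate v 0)
  degree≡ (e ∷ es) v = trans (step (v ∈? e)) (sym (lookup-zipWith _+_ v (indicator e) (degrees es)))
    where
    incident : ∀ i → Dec (v ∈ List.lookup (e ∷ es) i)
    incident i = v ∈? List.lookup (e ∷ es) i
    rest : length (filter incident (List.tabulate suc)) ≡ Vec.lookup (degrees es) v
    rest = trans (cong (length ∘ filter incident) (sym (map-tabulate id suc)))
          (trans (length-filter-map incident suc (allFin (length es))) (degree≡ es v))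
    step : Dec (v ∈ e) → length (filter incident (allFin (suc (length es)))) ≡
           Vec.lookup (indicator e) v + Vec.lookup (degrees es) v
    step (yes v∈e) = trans (cong length (filter-accept incident {zero} {List.tabulate suc} v∈e))
      (cong₂ _+_ (sym (trans (lookup-map v _ e) (cong (λ s → if s then 1 else 0) ([]=⇒lookup v∈e)))) rest)
    step (no v∉e)  = trans (cong length (filter-reject incident {zero} {List.tabulate suc} v∉e))
      (cong₂ _+_ (sym (trans (lookup-map v _ e) (cong (λ s → if s then 1 else 0) (≢inside (Vec.lookup e v) refl)))) rest)
      where
      ≢inside : ∀ s → Vec.lookup e v ≡ s → Vec.lookup e v ≡ outside
      ≢inside outside eq = eq
      ≢inside inside  eq = ⊥-elim (v∉e (lookup⇒[]= v e eq))

  hypergraph-Regular : ∀ {d} (es : Edges l) → degrees es ≡ Vec.replicate l d → Regular d (hypergraph es)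
  hypergraph-Regular {d = d} es eq v = trans (degree≡ es v) (trans (cong (λ ds → Vec.lookup ds v) eq) (lookup-replicate v d))

-- Ordered-field facts about ℚ and its natural numbers.

module Rationals where

  open import Defs using (frac; inv)
  open import Data.Nat as ℕ using (ℕ; zero; suc)
  import Data.Nat.Properties as ℕ
  open import Data.Nat.Coprimality using (Coprime)
  open import Data.Integer as ℤ using (+_; -[1+_])
  import Data.Integer.Properties as ℤ
  open import Data.Rational
  open import Data.Rational.Properties
  open import Data.Rational.Solver using (module +-*-Solver)
  import Data.Rational.Unnormalised as ℚᵘ
  import Data.Rational.Unnormalised.Properties as ℚᵘ
  open import Algebra using (CommutativeRing)
  open import Algebra.Properties.CommutativeSemiring.Exp
    (CommutativeRing.commutativeSemiring +-*-commutativeRing) public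
    using (_^_; ^-homo-*; ^-assocʳ; ^-distrib-*)
  open import Data.Product using (∃-syntax; _×_; _,_)
  open import Data.Empty using (⊥-elim)
  open import Relation.Binary.PropositionalEquality

  ι : ℕ → ℚ
  ι n = + n / 1

  private
    toℚᵘ-frac : ∀ a b → toℚᵘ (frac a (suc b)) ℚᵘ.≃ ℚᵘ.mkℚᵘ (+ a) b
    toℚᵘ-frac a b = toℚᵘ-fromℚᵘ (ℚᵘ.mkℚᵘ (+ a) b)

    toℚᵘ-ι : ∀ n → toℚᵘ (ι n) ℚᵘ.≃ ℚᵘ.mkℚᵘ (+ n) 0
    toℚᵘ-ι n = toℚᵘ-frac n 0

  ι-+ : ∀ m n → ι (m ℕ.+ n) ≡ ι m + ι n
  ι-+ m n = toℚᵘ-injective (ℚᵘ.≃-trans (toℚᵘ-ι (m ℕ.+ n)) (ℚᵘ.≃-trans (ℚᵘ.*≡* eq) (ℚᵘ.≃-sym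
    (ℚᵘ.≃-trans (toℚᵘ-homo-+ (ι m) (ι n)) (ℚᵘ.+-cong (toℚᵘ-ι m) (toℚᵘ-ι n))))))
    where
    eq : + (m ℕ.+ n) ℤ.* (+ 1) ≡ (+ m ℤ.* + 1 ℤ.+ + n ℤ.* + 1) ℤ.* + 1
    eq = cong (ℤ._* + 1) (sym (cong₂ ℤ._+_ (ℤ.*-identityʳ (+ m)) (ℤ.*-identityʳ (+ n))))

  ι-* : ∀ m n → ι (m ℕ.* n) ≡ ι m * ι n
  ι-* m n = toℚᵘ-injective (ℚᵘ.≃-trans (toℚᵘ-ι (m ℕ.* n)) (ℚᵘ.≃-trans (ℚᵘ.*≡* (cong (ℤ._* + 1) (ℤ.pos-* m n))) (ℚᵘ.≃-sym
    (ℚᵘ.≃-trans (toℚᵘ-homo-* (ι m) (ι n)) (ℚᵘ.*-cong (toℚᵘ-ι m) (toℚᵘ-ι n))))))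

  ι-suc : ∀ n → ι (suc n) ≡ 1ℚ + ι n
  ι-suc n = ι-+ 1 n

  ι-mono-≤ : ∀ {m n} → m ℕ.≤ n → ι m ≤ ι n
  ι-mono-≤ {m} {n} m≤n = toℚᵘ-cancel-≤ (ℚᵘ.≤-respˡ-≃ (ℚᵘ.≃-sym (toℚᵘ-ι m)) (ℚᵘ.≤-respʳ-≃ (ℚᵘ.≃-sym (toℚᵘ-ι n))
    (ℚᵘ.*≤* (ℤ.*-monoʳ-≤-nonNeg (+ 1) (ℤ.+≤+ m≤n)))))

  ι-injective : ∀ {m n} → ι m ≡ ι n → m ≡ n
  ι-injective {m} {n} eq with ℚᵘ.≃-trans (ℚᵘ.≃-sym (toℚᵘ-ι m)) (ℚᵘ.≃-trans (toℚᵘ-cong eq) (toℚᵘ-ι n))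
  ... | ℚᵘ.*≡* e = ℤ.+-injective (trans (sym (ℤ.*-identityʳ (+ m))) (trans e (ℤ.*-identityʳ (+ n))))

  0≤ι : ∀ n → 0ℚ ≤ ι n
  0≤ι n = ι-mono-≤ {0} {n} ℕ.z≤n

  0<ι : ∀ {n} → 1 ℕ.≤ n → 0ℚ < ι n
  0<ι {n} 1≤n = <-≤-trans (positive⁻¹ 1ℚ) (ι-mono-≤ {1} {n} 1≤n)

  frac-* : ∀ a {b} → 1 ℕ.≤ b → frac a b * ι b ≡ ι a
  frac-* a {suc b} _ = toℚᵘ-injective (ℚᵘ.≃-trans (toℚᵘ-homo-* (frac a (suc b)) (ι (suc b)))
    (ℚᵘ.≃-trans (ℚᵘ.*-cong (toℚᵘ-frac a b) (toℚᵘ-ι (suc b))) (ℚᵘ.≃-trans (ℚᵘ.*≡* eq) (ℚᵘ.≃-sym (toℚᵘ-ι a)))))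
    where
    eq : + a ℤ.* + suc b ℤ.* + 1 ≡ + a ℤ.* + (suc b ℕ.* 1)
    eq = trans (ℤ.*-identityʳ _) (cong (λ z → + a ℤ.* + z) (sym (ℕ.*-identityʳ (suc b))))

  inv-* : ∀ {b} → 1 ℕ.≤ b → inv b * ι b ≡ 1ℚ
  inv-* {suc b} 1≤b = frac-* 1 1≤b

  ≤-archimedean : ∀ p → ∃[ n ] p ≤ ι n
  ≤-archimedean p@(mkℚ (+ n) d-1 _) = n , toℚᵘ-cancel-≤ (ℚᵘ.≤-respʳ-≃ (ℚᵘ.≃-sym (toℚᵘ-ι n))
    (ℚᵘ.*≤* (ℤ.*-monoˡ-≤-nonNeg (+ n) (ℤ.+≤+ (ℕ.s≤s ℕ.z≤n)))))
  ≤-archimedean p@(mkℚ -[1+ n ] d-1 _) = 0 , toℚᵘ-cancel-≤ (ℚᵘ.*≤* ℤ.-≤+)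

  numerator-* : ∀ {n d} .{c : Coprime n (suc d)} → let p = mkℚ (+ n) d c in p * ι (suc d) ≡ ι n
  numerator-* {n} {d} {c} = trans (cong (_* ι (suc d)) (sym (↥p/↧p≡p (mkℚ (+ n) d c)))) (frac-* n (ℕ.s≤s ℕ.z≤n))

  -- The denominator of p is a witness, since p times it is a positive integer.
  reciprocal-archimedean : ∀ {p} → 0ℚ < p → ∃[ n ] 1 ℕ.≤ n × 1ℚ ≤ p * ι n
  reciprocal-archimedean {mkℚ (+ suc n) d c} _ = suc d , ℕ.s≤s ℕ.z≤n ,
    ≤-trans (ι-mono-≤ {1} {suc n} (ℕ.s≤s ℕ.z≤n)) (≤-reflexive (sym (numerator-* {suc n} {d} {c})))
  reciprocal-archimedean {mkℚ (+ 0) d c} 0<p = ⊥-elim (<-irrefl (sym (↥p≡0⇒p≡0 (mkℚ (+ 0) d c) refl)) 0<p)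
  reciprocal-archimedean {mkℚ -[1+ n ] d c} (*<* ())

  0≤1 : 0ℚ ≤ 1ℚ
  0≤1 = nonNegative⁻¹ 1ℚ

  0<1 : 0ℚ < 1ℚ
  0<1 = positive⁻¹ 1ℚ

  *-monoˡ : ∀ {r p q} → 0ℚ ≤ r → p ≤ q → r * p ≤ r * q
  *-monoˡ {r} 0≤r = *-monoˡ-≤-nonNeg r {{nonNegative 0≤r}}

  *-monoʳ : ∀ {r p q} → 0ℚ ≤ r → p ≤ q → p * r ≤ q * r
  *-monoʳ {r} 0≤r = *-monoʳ-≤-nonNeg r {{nonNegative 0≤r}}

  *-monoˡ-< : ∀ {r p q} → 0ℚ < r → p < q → r * p < r * q
  *-monoˡ-< {r} 0<r = *-monoʳ-<-pos r {{positive 0<r}}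

  *-monoʳ-< : ∀ {r p q} → 0ℚ < r → p < q → p * r < q * r
  *-monoʳ-< {r} 0<r = *-monoˡ-<-pos r {{positive 0<r}}

  *-mono : ∀ {p q r s} → 0ℚ ≤ q → 0ℚ ≤ r → p ≤ q → r ≤ s → p * r ≤ q * s
  *-mono 0≤q 0≤r p≤q r≤s = ≤-trans (*-monoʳ 0≤r p≤q) (*-monoˡ 0≤q r≤s)

  0≤* : ∀ {p q} → 0ℚ ≤ p → 0ℚ ≤ q → 0ℚ ≤ p * q
  0≤* {p} 0≤p 0≤q = ≤-trans (≤-reflexive (sym (*-zeroʳ p))) (*-monoˡ 0≤p 0≤q)

  0<* : ∀ {p q} → 0ℚ < p → 0ℚ < q → 0ℚ < p * q
  0<* {p} 0<p 0<q = ≤-<-trans (≤-reflexive (sym (*-zeroʳ p))) (*-monoˡ-< 0<p 0<q)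

  p≤p+q : ∀ {p q} → 0ℚ ≤ q → p ≤ p + q
  p≤p+q {p} 0≤q = ≤-trans (≤-reflexive (sym (+-identityʳ p))) (+-monoʳ-≤ p 0≤q)

  p<p+q : ∀ {p q} → 0ℚ < q → p < p + q
  p<p+q {p} 0<q = ≤-<-trans (≤-reflexive (sym (+-identityʳ p))) (+-monoʳ-< p 0<q)

  p≤q+p : ∀ {p q} → 0ℚ ≤ q → p ≤ q + p
  p≤q+p {p} {q} 0≤q = ≤-trans (p≤p+q 0≤q) (≤-reflexive (+-comm p q))

  *-cancelˡ : ∀ {r p q} → 0ℚ < r → r * p ≤ r * q → p ≤ q
  *-cancelˡ {r} 0<r = *-cancelˡ-≤-pos r {{positive 0<r}}

  ^-nonNeg : ∀ {x} n → 0ℚ ≤ x → 0ℚ ≤ x ^ n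
  ^-nonNeg zero    0≤x = 0≤1
  ^-nonNeg (suc n) 0≤x = 0≤* 0≤x (^-nonNeg n 0≤x)

  ^-pos : ∀ {x} n → 0ℚ < x → 0ℚ < x ^ n
  ^-pos zero    0<x = 0<1
  ^-pos (suc n) 0<x = 0<* 0<x (^-pos n 0<x)

  ^-mono-≤ : ∀ {x y} n → 0ℚ ≤ x → x ≤ y → x ^ n ≤ y ^ n
  ^-mono-≤ zero    0≤x x≤y = ≤-refl
  ^-mono-≤ (suc n) 0≤x x≤y = *-mono (≤-trans 0≤x x≤y) (^-nonNeg n 0≤x) x≤y (^-mono-≤ n 0≤x x≤y)

  ^-mono-< : ∀ {x y} n → 0ℚ ≤ x → x < y → x ^ suc n < y ^ suc n
  ^-mono-< {x} {y} n 0≤x x<y = ≤-<-trans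
    (*-monoˡ 0≤x (^-mono-≤ n 0≤x (<⇒≤ x<y)))
    (*-monoʳ-< (^-pos n (≤-<-trans 0≤x x<y)) x<y)

  1≤^ : ∀ {x} n → 1ℚ ≤ x → 1ℚ ≤ x ^ n
  1≤^ zero    1≤x = ≤-refl
  1≤^ (suc n) 1≤x = ≤-trans (1≤^ n 1≤x)
    (≤-trans (≤-reflexive (sym (*-identityˡ _))) (*-monoʳ (≤-trans 0≤1 (1≤^ n 1≤x)) 1≤x))

  -- Being reciprocal is expressed by a product equal to 1, so no division and no nonzero proofs
  -- enter.
  reciprocal-antitone : ∀ {a b a′ b′} → 0ℚ < a → 0ℚ < a′ → a * b ≡ 1ℚ → a′ * b′ ≡ 1ℚ → b ≤ b′ → a′ ≤ a
  reciprocal-antitone {a} {b} {a′} {b′} 0<a 0<a′ ab≡1 a′b′≡1 b≤b′ = begin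
    a′            ≡⟨ *-identityʳ a′ ⟨
    a′ * 1ℚ       ≡⟨ cong (a′ *_) ab≡1 ⟨
    a′ * (a * b)  ≤⟨ *-monoˡ (<⇒≤ 0<a′) (*-monoˡ (<⇒≤ 0<a) b≤b′) ⟩
    a′ * (a * b′) ≡⟨ solve 3 (λ a a′ b′ → a′ :* (a :* b′) := a :* (a′ :* b′)) refl a a′ b′ ⟩
    a * (a′ * b′) ≡⟨ cong (a *_) a′b′≡1 ⟩
    a * 1ℚ        ≡⟨ *-identityʳ a ⟩
    a             ∎
    where
    open ≤-Reasoning
    open +-*-Solver

  reciprocal-antitone-< : ∀ {a b a′ b′} → 0ℚ < a → 0ℚ < a′ → a * b ≡ 1ℚ → a′ * b′ ≡ 1ℚ → b < b′ → a′ < a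
  reciprocal-antitone-< {a} {b} {a′} {b′} 0<a 0<a′ ab≡1 a′b′≡1 b<b′ = begin-strict
    a′            ≡⟨ *-identityʳ a′ ⟨
    a′ * 1ℚ       ≡⟨ cong (a′ *_) ab≡1 ⟨
    a′ * (a * b)  <⟨ *-monoˡ-< 0<a′ (*-monoˡ-< 0<a b<b′) ⟩
    a′ * (a * b′) ≡⟨ solve 3 (λ a a′ b′ → a′ :* (a :* b′) := a :* (a′ :* b′)) refl a a′ b′ ⟩
    a * (a′ * b′) ≡⟨ cong (a *_) a′b′≡1 ⟩
    a * 1ℚ        ≡⟨ *-identityʳ a ⟩
    a             ∎
    where
    open ≤-Reasoning
    open +-*-Solver

  ι-^ : ∀ a n → ι (a ℕ.^ n) ≡ ι a ^ n
  ι-^ a zero    = refl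
  ι-^ a (suc n) = trans (ι-* a (a ℕ.^ n)) (cong (ι a *_) (ι-^ a n))

  *-cancelˡ-≡ : ∀ {r p q} → 0ℚ < r → r * p ≡ r * q → p ≡ q
  *-cancelˡ-≡ 0<r eq = ≤-antisym (*-cancelˡ 0<r (≤-reflexive eq)) (*-cancelˡ 0<r (≤-reflexive (sym eq)))

  frac-unique : ∀ {r} a {b} → 1 ℕ.≤ b → r * ι b ≡ ι a → r ≡ frac a b
  frac-unique {r} a {b} 1≤b eq = *-cancelˡ-≡ (0<ι {b} 1≤b)
    (trans (*-comm (ι b) r) (trans eq (trans (sym (frac-* a 1≤b)) (*-comm (frac a b) (ι b)))))

  frac-pos : ∀ {a b} → 1 ℕ.≤ a → 1 ℕ.≤ b → 0ℚ < frac a b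
  frac-pos {a} {b} 1≤a 1≤b = *-cancelʳ-<-nonNeg (ι b) {{nonNegative (0≤ι b)}}
    (<-respʳ-≡ (sym (frac-* a 1≤b)) (≤-<-trans (≤-reflexive (*-zeroˡ (ι b))) (0<ι {a} 1≤a)))

  inv-pos : ∀ {b} → 1 ℕ.≤ b → 0ℚ < inv b
  inv-pos {b} 1≤b = *-cancelʳ-<-nonNeg (ι b) {{nonNegative (0≤ι b)}}
    (<-respʳ-≡ (sym (inv-* 1≤b)) (≤-<-trans (≤-reflexive (*-zeroˡ (ι b))) 0<1))

  inv≤1 : ∀ {b} → 1 ℕ.≤ b → inv b ≤ 1ℚ
  inv≤1 {b} 1≤b = begin
    inv b          ≡⟨ *-identityʳ (inv b) ⟨
    inv b * 1ℚ     ≤⟨ *-monoˡ (<⇒≤ (inv-pos 1≤b)) (ι-mono-≤ {1} {b} 1≤b) ⟩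
    inv b * ι b    ≡⟨ inv-* 1≤b ⟩
    1ℚ             ∎
    where open ≤-Reasoning

-- The iteration x ↦ 1 / (1 + c xᵐ): escape from the fixed point, and estimates at the root.

module Dynamics where

  open Rationals
  open import Data.Nat as ℕ using (ℕ; zero; suc)
  import Data.Nat.Properties as ℕ
  open import Data.Nat.Divisibility using (_∣_; m∣m*n; ∣1⇒≡1)
  open import Data.Nat.Coprimality as Coprimality using (Coprime; coprime-divisor)
  import Data.Integer as ℤ
  open import Data.Rational
  open import Data.Rational.Properties
  open import Data.Rational.Solver using (module +-*-Solver)
  open import Defs using (frac; inv)
  open import Data.Product using (∃-syntax; _×_; _,_; proj₁; proj₂)
  open import Data.Sum using (_⊎_; inj₁; inj₂)
  open import Data.Empty using (⊥; ⊥-elim)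
  open import Relation.Nullary using (yes; no)
  open import Relation.Binary.PropositionalEquality
  open import Relation.Binary.Definitions using (tri<; tri≈; tri>)

  two three : ℚ
  two   = 1ℚ + 1ℚ
  three = 1ℚ + two

  -- By convexity the power lies below its chord over [0, 1], which is 1 + (2ⁿ - 1) δ; `go` keeps
  -- the subtracted δ on the left.
  [1+δ]^n≤1+2^nδ : ∀ {δ} n → 0ℚ ≤ δ → δ ≤ 1ℚ → (1ℚ + δ) ^ n ≤ 1ℚ + two ^ n * δ
  [1+δ]^n≤1+2^nδ {δ} n 0≤δ δ≤1 = ≤-trans (p≤p+q 0≤δ) (go n)
    where
    open ≤-Reasoning
    open +-*-Solver
    go : ∀ n → (1ℚ + δ) ^ n + δ ≤ 1ℚ + two ^ n * δ
    go zero    = ≤-reflexive (cong (1ℚ +_) (sym (*-identityˡ δ)))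
    go (suc n) = begin
      (1ℚ + δ) * (1ℚ + δ) ^ n + δ
        ≡⟨ solve 2 (λ δ a → (con 1ℚ :+ δ) :* a :+ δ := (a :+ δ) :+ a :* δ) refl δ ((1ℚ + δ) ^ n) ⟩
      ((1ℚ + δ) ^ n + δ) + (1ℚ + δ) ^ n * δ
        ≤⟨ +-mono-≤ (go n) (*-monoʳ 0≤δ (^-mono-≤ n (≤-trans 0≤1 (p≤p+q 0≤δ)) (+-monoʳ-≤ 1ℚ δ≤1))) ⟩
      (1ℚ + two ^ n * δ) + two ^ n * δ
        ≡⟨ solve 2 (λ δ a → (con 1ℚ :+ a :* δ) :+ a :* δ := con 1ℚ :+ (con two :* a) :* δ) refl δ (two ^ n) ⟩
      1ℚ + two ^ suc n * δ ∎

  -- The division-free form of y = 1 / (1 + c xᵐ).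
  record Follows (c : ℚ) (m : ℕ) (x y : ℚ) : Set where
    constructor follows
    field equation : y * (1ℚ + c * x ^ m) ≡ 1ℚ
  open Follows

  Follows-antitone : ∀ {c m x x′ y y′} → 0ℚ ≤ c → 0ℚ ≤ x → 0ℚ < y → 0ℚ < y′ →
                     Follows c m x y → Follows c m x′ y′ → x ≤ x′ → y′ ≤ y
  Follows-antitone {m = m} 0≤c 0≤x 0<y 0<y′ f f′ x≤x′ =
    reciprocal-antitone 0<y 0<y′ (equation f) (equation f′)
      (+-monoʳ-≤ 1ℚ (*-monoˡ 0≤c (^-mono-≤ m 0≤x x≤x′)))

  Follows-antitone-< : ∀ {c m x x′ y y′} → 0ℚ < c → 0ℚ ≤ x → 0ℚ < y → 0ℚ < y′ →
                       Follows c (suc m) x y → Follows c (suc m) x′ y′ → x < x′ → y′ < y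
  Follows-antitone-< {m = m} 0<c 0≤x 0<y 0<y′ f f′ x<x′ =
    reciprocal-antitone-< 0<y 0<y′ (equation f) (equation f′)
      (+-monoʳ-< 1ℚ (*-monoˡ-< 0<c (^-mono-< m 0≤x x<x′)))

  -- This is 2 · 3^(m-1) for m = p + 2: the power of 3 compensates y^(m-1) when y is only known to
  -- be at least 1/3, and the 2 is the expansion rate required in `two-step`. It does not depend on
  -- c, so a value below it forces x to be of order 1/c.
  threshold : ℕ → ℚ
  threshold p = two * three ^ suc p

  module _ (c : ℚ) (0<c : 0ℚ < c) (p : ℕ) where

    private
      m = suc (suc p)
      0≤c = <⇒≤ 0<c

    private
      -- the factor that makes the two-step map expand away from its unstable fixed point
      2≤cxyᵖ : ∀ {x y} → 0ℚ < x → x ≤ y → Follows c m x y → threshold p ≤ c * x → two ≤ c * x * y ^ suc p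
      2≤cxyᵖ {x} {y} 0<x x≤y f B≤cx with two ≤? c * x ^ m
      -- If c xᵐ ≥ 2, then x ≤ y suffices. Otherwise the equation for y gives y ≥ 1/3, and the size
      -- of c x makes up for the small power of y.
      ... | yes 2≤cxᵐ = begin
        two                  ≤⟨ 2≤cxᵐ ⟩
        c * (x * x ^ suc p)  ≡⟨ *-assoc c x _ ⟨
        c * x * x ^ suc p    ≤⟨ *-monoˡ (0≤* 0≤c (<⇒≤ 0<x)) (^-mono-≤ (suc p) (<⇒≤ 0<x) x≤y) ⟩
        c * x * y ^ suc p    ∎
        where open ≤-Reasoning
      ... | no 2≰cxᵐ = begin
        two                              ≡⟨ *-identityʳ two ⟨
        two * 1ℚ                         ≤⟨ *-monoˡ (nonNegative⁻¹ two) (1≤^ (suc p) 1≤3y) ⟩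
        two * (three * y) ^ suc p        ≡⟨ cong (two *_) (^-distrib-* three y (suc p)) ⟩
        two * (three ^ suc p * y ^ suc p) ≡⟨ *-assoc two (three ^ suc p) (y ^ suc p) ⟨
        threshold p * y ^ suc p            ≤⟨ *-monoʳ (^-nonNeg (suc p) 0≤y) B≤cx ⟩
        c * x * y ^ suc p                ∎
        where
        open ≤-Reasoning
        0≤y = ≤-trans (<⇒≤ 0<x) x≤y
        1≤3y : 1ℚ ≤ three * y
        1≤3y = begin
          1ℚ                   ≡⟨ equation f ⟨
          y * (1ℚ + c * x ^ m) ≤⟨ *-monoˡ 0≤y (+-monoʳ-≤ 1ℚ (<⇒≤ (≰⇒> 2≰cxᵐ))) ⟩
          y * three            ≡⟨ *-comm y three ⟩
          three * y            ∎

    -- Let y = x + D. Since z = 1 / (1 + c yᵐ), the claim is 1 + D ≤ x + c x yᵐ. Writing the 1 as y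
    -- (1 + c xᵐ) on the left, and one factor y of yᵐ as x + D on the right, reduces it to comparing
    -- 2 D with D · c x y^(m-1), plus terms ordered by x ≤ y.
    two-step : ∀ {x D z} → 0ℚ < x → 0ℚ ≤ D → 0ℚ < z → Follows c m x (x + D) → Follows c m (x + D) z →
               threshold p ≤ c * x → z * (1ℚ + D) ≤ x
    two-step {x} {D} {z} 0<x 0≤D 0<z f g B≤cx = begin
      z * (1ℚ + D)             ≤⟨ *-monoˡ (<⇒≤ 0<z) expansion ⟩
      z * (x + c * x * y ^ m)  ≡⟨ solve 4 (λ z x c a → z :* (x :+ (c :* x) :* a) := x :* (z :* (con 1ℚ :+ c :* a))) refl z x c (y ^ m) ⟩
      x * (z * (1ℚ + c * y ^ m)) ≡⟨ cong (x *_) (equation g) ⟩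
      x * 1ℚ                   ≡⟨ *-identityʳ x ⟩
      x                        ∎
      where
      open ≤-Reasoning
      open +-*-Solver
      y = x + D
      0≤x = <⇒≤ 0<x
      x≤y : x ≤ y
      x≤y = p≤p+q 0≤D
      0≤y = ≤-trans 0≤x x≤y
      expansion : 1ℚ + D ≤ x + c * x * y ^ m
      expansion = begin
        1ℚ + D
          ≡⟨ cong (_+ D) (equation f) ⟨
        y * (1ℚ + c * x ^ m) + D
          ≡⟨ solve 4 (λ x D c a → (x :+ D) :* (con 1ℚ :+ c :* (x :* (x :* a))) :+ D :=
                       x :+ (D :* con two :+ (c :* x :* (x :* (x :+ D))) :* a)) refl x D c (x ^ p) ⟩
        x + (D * two + c * x * (x * y) * x ^ p)
          ≤⟨ +-monoʳ-≤ x (+-mono-≤ (*-monoˡ 0≤D (2≤cxyᵖ 0<x x≤y f B≤cx))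
               (*-monoˡ (0≤* (0≤* 0≤c 0≤x) (0≤* 0≤x 0≤y)) (^-mono-≤ p 0≤x x≤y))) ⟩
        x + (D * (c * x * y ^ suc p) + c * x * (x * y) * y ^ p)
          ≡⟨ solve 4 (λ x D c b → x :+ (D :* (c :* x :* ((x :+ D) :* b)) :+ c :* x :* (x :* (x :+ D)) :* b) :=
                       x :+ c :* x :* ((x :+ D) :* ((x :+ D) :* b))) refl x D c (y ^ p) ⟩
        x + c * x * y ^ m ∎

    module _ {x : ℕ → ℚ} (0<x : ∀ i → 0ℚ < x i) (x-follows : ∀ i → Follows c m (x i) (x (suc i)))
             (x₀≤1 : x 0 ≤ 1ℚ) {D : ℚ} (0<D : 0ℚ < D) (x₀+D≤x₁ : x 0 + D ≤ x 1) where

      private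
        double : ℕ → ℕ
        double zero    = zero
        double (suc n) = suc (suc (double n))

        0≤D = <⇒≤ 0<D

        -- Until the threshold is passed, even-indexed values decrease, so by antitonicity
        -- odd-indexed ones do not, and the gap stays at least D. Each double step divides the even
        -- value by at least 1 + D; the linear bound 1 + n D on the accumulated factor is
        -- Bernoulli's inequality.
        descent : ∀ n → (∃[ i ] c * x i < threshold p) ⊎
                  (x (double n) + D ≤ x (suc (double n)) × x (double n) * (1ℚ + ι n * D) ≤ 1ℚ)
        descent zero = inj₂ (x₀+D≤x₁ , ≤-trans (≤-reflexive
          (solve 2 (λ x D → x :* (con 1ℚ :+ con 0ℚ :* D) := x) refl (x 0) D)) x₀≤1)
          where open +-*-Solver
        descent (suc n) with descent n
        ... | inj₁ found = inj₁ found
        ... | inj₂ (gap , bound) with threshold p ≤? c * x (double n)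
        ...   | no  B≰cx = inj₁ (double n , ≰⇒> B≰cx)
        ...   | yes B≤cx = inj₂ (gap′ , bound′)
          where
          open ≤-Reasoning
          open +-*-Solver
          i = double n
          X Y Z D′ : ℚ
          X = x i
          Y = x (suc i)
          Z = x (suc (suc i))
          -- `two-step` needs the exact current gap, whereas the invariant carries only the lower
          -- bound D.
          D′ = Y - X
          X+D′≡Y : X + D′ ≡ Y
          X+D′≡Y = solve 2 (λ x y → x :+ (y :- x) := y) refl X Y
          D≤D′ : D ≤ D′
          D≤D′ = begin
            D           ≡⟨ solve 2 (λ x d → d := (x :+ d) :- x) refl X D ⟩
            X + D - X   ≤⟨ +-monoˡ-≤ (- X) gap ⟩
            D′          ∎
          Z[1+D]≤X : Z * (1ℚ + D) ≤ X
          Z[1+D]≤X = ≤-trans (*-monoˡ (<⇒≤ (0<x _)) (+-monoʳ-≤ 1ℚ D≤D′))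
            (two-step (0<x i) (≤-trans 0≤D D≤D′) (0<x _)
              (subst (Follows c m X) (sym X+D′≡Y) (x-follows i))
              (subst (λ y → Follows c m y Z) (sym X+D′≡Y) (x-follows (suc i))) B≤cx)
          Z≤X : Z ≤ X
          Z≤X = ≤-trans (≤-trans (≤-reflexive (sym (*-identityʳ Z))) (*-monoˡ (<⇒≤ (0<x _)) (p≤p+q 0≤D))) Z[1+D]≤X
          gap′ : Z + D ≤ x (suc (suc (suc i)))
          gap′ = ≤-trans (+-monoˡ-≤ D Z≤X) (≤-trans gap
            (Follows-antitone {m = m} 0≤c (<⇒≤ (0<x _)) (0<x _) (0<x _) (x-follows (suc (suc i))) (x-follows i) Z≤X))
          bound′ : Z * (1ℚ + ι (suc n) * D) ≤ 1ℚ
          bound′ = begin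
            Z * (1ℚ + ι (suc n) * D)        ≡⟨ cong (λ z → Z * (1ℚ + z * D)) (ι-suc n) ⟩
            Z * (1ℚ + (1ℚ + ι n) * D)       ≤⟨ *-monoˡ (<⇒≤ (0<x _)) (p≤p+q (0≤* (0≤* (0≤ι n) 0≤D) 0≤D)) ⟩
            Z * (1ℚ + (1ℚ + ι n) * D + ι n * D * D)
              ≡⟨ solve 3 (λ z n d → z :* (con 1ℚ :+ (con 1ℚ :+ n) :* d :+ n :* d :* d) :=
                                    (z :* (con 1ℚ :+ d)) :* (con 1ℚ :+ n :* d)) refl Z (ι n) D ⟩
            (Z * (1ℚ + D)) * (1ℚ + ι n * D) ≤⟨ *-monoʳ (≤-trans 0≤1 (p≤p+q (0≤* (0≤ι n) 0≤D))) Z[1+D]≤X ⟩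
            X * (1ℚ + ι n * D)              ≤⟨ bound ⟩
            1ℚ                              ∎

      -- The bound x ≤ 1 / (1 + n D) already forces c x < 1 once n D ≥ c.
      reaches-threshold : ∀ n → c ≤ ι n * D → 1ℚ ≤ threshold p → ∃[ i ] c * x i < threshold p
      reaches-threshold n c≤nD 1≤B with descent n
      ... | inj₁ found = found
      ... | inj₂ (_ , bound) = double n , (begin-strict
        c * X                   ≤⟨ *-monoʳ (<⇒≤ (0<x _)) c≤nD ⟩
        ι n * D * X             <⟨ p<p+q (0<x _) ⟩
        ι n * D * X + X         ≡⟨ solve 2 (λ a x → a :* x :+ x := x :* (con 1ℚ :+ a)) refl (ι n * D) X ⟩
        X * (1ℚ + ι n * D)      ≤⟨ bound ⟩
        1ℚ                      ≤⟨ 1≤B ⟩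
        threshold p               ∎)
        where
        open ≤-Reasoning
        open +-*-Solver
        X = x (double n)

    -- Here m ≥ 2 matters: c ≤ c^(m-1) gives c · c xᵐ ≤ (c x)ᵐ ≤ c δ, hence c xᵐ ≤ δ.
    below-threshold : ∀ {x y δ} → 0ℚ < x → 0ℚ < y → 1ℚ ≤ c → threshold p ^ m ≤ c * δ →
                      Follows c m x y → c * x < threshold p → 1ℚ ≤ y * (1ℚ + δ)
    below-threshold {x} {y} {δ} 0<x 0<y 1≤c Bᵐ≤cδ f cx<B =
      ≤-trans (≤-reflexive (sym (equation f))) (*-monoˡ (<⇒≤ 0<y) (+-monoʳ-≤ 1ℚ (*-cancelˡ 0<c (begin
        c * (c * x ^ m)               ≤⟨ *-monoʳ (0≤* 0≤c (^-nonNeg m (<⇒≤ 0<x))) c≤c^ ⟩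
        c ^ suc p * (c * x ^ m)       ≡⟨ solve 3 (λ a c x → a :* (c :* x) := (c :* a) :* x) refl (c ^ suc p) c (x ^ m) ⟩
        c ^ m * x ^ m                 ≡⟨ ^-distrib-* c x m ⟨
        (c * x) ^ m                   ≤⟨ ^-mono-≤ m (0≤* 0≤c (<⇒≤ 0<x)) (<⇒≤ cx<B) ⟩
        threshold p ^ m                 ≤⟨ Bᵐ≤cδ ⟩
        c * δ                         ∎))))
      where
      open ≤-Reasoning
      open +-*-Solver
      c≤c^ : c ≤ c ^ suc p
      c≤c^ = ≤-trans (≤-reflexive (sym (*-identityʳ c))) (*-monoˡ 0≤c (1≤^ p 1≤c))

    -- With d = 1 + c and q = 1 / (d + 1): from yᵐ (1 + ε) ≥ 1 follows X (1 + ε + d) ≤ 1 + ε, and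
    -- lowering 1 + ε to 1 on the left makes the inequality strict.
    root-covered : ∀ {y δ ε X q} → 0ℚ < y → 0ℚ ≤ δ → (1ℚ + δ) ^ m ≤ 1ℚ + ε → 0ℚ < ε → 0ℚ < X →
                   1ℚ ≤ y * (1ℚ + δ) → Follows (1ℚ + c) m y X → q * (1ℚ + (1ℚ + c)) ≡ 1ℚ →
                   X < (1ℚ + ε) * q
    root-covered {y} {δ} {ε} {X} {q} 0<y 0≤δ δ-small 0<ε 0<X 1≤y[1+δ] f q≡ =
      *-cancelʳ-<-nonNeg (1ℚ + (1ℚ + c)) {{nonNegative 0≤1+1+c}} (begin-strict
        X * (1ℚ + (1ℚ + c))
          <⟨ *-monoˡ-< 0<X (+-monoˡ-< (1ℚ + c) (p<p+q {1ℚ} {ε} 0<ε)) ⟩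
        X * ((1ℚ + ε) + (1ℚ + c))
          ≡⟨ cong (λ z → X * ((1ℚ + ε) + z)) (*-identityʳ (1ℚ + c)) ⟨
        X * ((1ℚ + ε) + (1ℚ + c) * 1ℚ)
          ≤⟨ *-monoˡ (<⇒≤ 0<X) (+-monoʳ-≤ (1ℚ + ε) (*-monoˡ 0≤1+c 1≤yᵐ[1+ε])) ⟩
        X * ((1ℚ + ε) + (1ℚ + c) * (y ^ m * (1ℚ + ε)))
          ≡⟨ solve 4 (λ x e c a → x :* (e :+ c :* (a :* e)) := e :* (x :* (con 1ℚ :+ c :* a))) refl X (1ℚ + ε) (1ℚ + c) (y ^ m) ⟩
        (1ℚ + ε) * (X * (1ℚ + (1ℚ + c) * y ^ m))
          ≡⟨ cong ((1ℚ + ε) *_) (trans (equation f) (sym q≡)) ⟩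
        (1ℚ + ε) * (q * (1ℚ + (1ℚ + c)))
          ≡⟨ *-assoc (1ℚ + ε) q _ ⟨
        (1ℚ + ε) * q * (1ℚ + (1ℚ + c)) ∎)
      where
      open ≤-Reasoning
      open +-*-Solver
      0≤1+c : 0ℚ ≤ 1ℚ + c
      0≤1+c = ≤-trans 0≤1 (p≤p+q 0≤c)
      0≤1+1+c : 0ℚ ≤ 1ℚ + (1ℚ + c)
      0≤1+1+c = ≤-trans 0≤1 (p≤p+q 0≤1+c)
      1≤yᵐ[1+ε] : 1ℚ ≤ y ^ m * (1ℚ + ε)
      1≤yᵐ[1+ε] = begin
        1ℚ                    ≤⟨ 1≤^ m 1≤y[1+δ] ⟩
        (y * (1ℚ + δ)) ^ m    ≡⟨ ^-distrib-* y (1ℚ + δ) m ⟩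
        y ^ m * (1ℚ + δ) ^ m  ≤⟨ *-monoˡ (^-nonNeg m (<⇒≤ 0<y)) δ-small ⟩
        y ^ m * (1ℚ + ε)      ∎

    -- With d = 1 + c and q = 1 / d^(m-1): 1 - X = X d zᵐ < d zᵐ = (d z)ᵐ q. The exponent on 1 + δ
    -- arises as follows: y near 1 costs m factors in the bound on c z, replacing c by d costs one
    -- more, and the m-th power multiplies these m + 1 by m.
    root-uncovered : ∀ {y z δ ε X q} → 0ℚ < y → 0ℚ < z → 0ℚ ≤ δ → (1ℚ + δ) ^ (suc m ℕ.* m) ≤ 1ℚ + ε →
                     1ℚ ≤ c * δ → 0ℚ < X → 0ℚ ≤ q → 1ℚ ≤ y * (1ℚ + δ) → Follows c m y z →
                     Follows (1ℚ + c) m z X → q * (1ℚ + c) ^ suc p ≡ 1ℚ → 1ℚ - (1ℚ + ε) * q < X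
    root-uncovered {y} {z} {δ} {ε} {X} {q} 0<y 0<z 0≤δ δ-small 1≤cδ 0<X 0≤q 1≤y[1+δ] f g q≡ = begin-strict
      1ℚ - (1ℚ + ε) * q              <⟨ +-monoˡ-< (- ((1ℚ + ε) * q)) 1<X+ ⟩
      X + (1ℚ + ε) * q - (1ℚ + ε) * q ≡⟨ solve 2 (λ x e → x :+ e :- e := x) refl X ((1ℚ + ε) * q) ⟩
      X                              ∎
      where
      open ≤-Reasoning
      open +-*-Solver
      d = 1ℚ + c
      0<d : 0ℚ < d
      0<d = <-trans 0<1 (p<p+q 0<c)
      0≤z = <⇒≤ 0<z
      0≤1+δ : 0ℚ ≤ 1ℚ + δ
      0≤1+δ = ≤-trans 0≤1 (p≤p+q 0≤δ)
      cz≤ : c * z ≤ (1ℚ + δ) ^ m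
      cz≤ = begin
        c * z                            ≡⟨ *-identityʳ (c * z) ⟨
        c * z * 1ℚ                       ≤⟨ *-monoˡ (0≤* 0≤c 0≤z) (1≤^ m 1≤y[1+δ]) ⟩
        c * z * (y * (1ℚ + δ)) ^ m       ≡⟨ cong (c * z *_) (^-distrib-* y (1ℚ + δ) m) ⟩
        c * z * (y ^ m * (1ℚ + δ) ^ m)   ≡⟨ solve 4 (λ c z a b → c :* z :* (a :* b) := (z :* (c :* a)) :* b) refl c z (y ^ m) ((1ℚ + δ) ^ m) ⟩
        z * (c * y ^ m) * (1ℚ + δ) ^ m   ≤⟨ *-monoʳ (^-nonNeg m 0≤1+δ) (*-monoˡ 0≤z (p≤q+p 0≤1)) ⟩
        z * (1ℚ + c * y ^ m) * (1ℚ + δ) ^ m ≡⟨ cong (_* (1ℚ + δ) ^ m) (equation f) ⟩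
        1ℚ * (1ℚ + δ) ^ m                ≡⟨ *-identityˡ _ ⟩
        (1ℚ + δ) ^ m                     ∎
      dz≤ : d * z ≤ (1ℚ + δ) ^ suc m
      dz≤ = begin
        d * z                     ≤⟨ *-monoʳ 0≤z (+-monoˡ-≤ c 1≤cδ) ⟩
        (c * δ + c) * z           ≡⟨ solve 3 (λ c e z → (c :* e :+ c) :* z := (con 1ℚ :+ e) :* (c :* z)) refl c δ z ⟩
        (1ℚ + δ) * (c * z)        ≤⟨ *-monoˡ 0≤1+δ cz≤ ⟩
        (1ℚ + δ) ^ suc m          ∎
      [dz]ᵐ≤ : (d * z) ^ m ≤ 1ℚ + ε
      [dz]ᵐ≤ = ≤-trans (^-mono-≤ m (0≤* (<⇒≤ 0<d) 0≤z) dz≤)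
               (≤-trans (≤-reflexive (^-assocʳ (1ℚ + δ) (suc m) m)) δ-small)
      0<dzᵐ : 0ℚ < d * z ^ m
      0<dzᵐ = 0<* 0<d (^-pos m 0<z)
      X<1 : X < 1ℚ
      X<1 = begin-strict
        X                       ≡⟨ *-identityʳ X ⟨
        X * 1ℚ                  <⟨ *-monoˡ-< 0<X (p<p+q 0<dzᵐ) ⟩
        X * (1ℚ + d * z ^ m)    ≡⟨ equation g ⟩
        1ℚ                      ∎
      1<X+ : 1ℚ < X + (1ℚ + ε) * q
      1<X+ = begin-strict
        1ℚ                          ≡⟨ equation g ⟨
        X * (1ℚ + d * z ^ m)        ≡⟨ solve 2 (λ x a → x :* (con 1ℚ :+ a) := x :+ x :* a) refl X (d * z ^ m) ⟩
        X + X * (d * z ^ m)         <⟨ +-monoʳ-< X (*-monoʳ-< 0<dzᵐ X<1) ⟩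
        X + 1ℚ * (d * z ^ m)        ≡⟨ cong (λ u → X + u * (d * z ^ m)) q≡ ⟨
        X + q * d ^ suc p * (d * z ^ m) ≡⟨ solve 5 (λ x q a d b → x :+ q :* a :* (d :* b) := x :+ (d :* a :* b) :* q) refl X q (d ^ suc p) d (z ^ m) ⟩
        X + d ^ m * z ^ m * q       ≡⟨ cong (λ u → X + u * q) (^-distrib-* d z m) ⟨
        X + (d * z) ^ m * q         ≤⟨ +-monoʳ-≤ X (*-monoʳ 0≤q [dz]ᵐ≤) ⟩
        X + (1ℚ + ε) * q            ∎

  Follows⇒≤1 : ∀ {c m x y} → 0ℚ ≤ c → 0ℚ ≤ x → 0ℚ < y → Follows c m x y → y ≤ 1ℚ
  Follows⇒≤1 {m = m} 0≤c 0≤x 0<y (follows f) = ≤-trans (≤-reflexive (sym (*-identityʳ _)))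
    (≤-trans (*-monoˡ (<⇒≤ 0<y) (p≤p+q (0≤* 0≤c (^-nonNeg m 0≤x)))) (≤-reflexive f))


  1≤threshold : ∀ p → 1ℚ ≤ threshold p
  1≤threshold p = *-mono {1ℚ} {two} {1ℚ} (nonNegative⁻¹ two) 0≤1 (p≤p+q 0≤1) (1≤^ (suc p) (p≤p+q (nonNegative⁻¹ two)))

  ι-threshold : ∀ p → ι (2 ℕ.* 3 ℕ.^ suc p) ≡ threshold p
  ι-threshold p = trans (ι-* 2 (3 ℕ.^ suc p)) (cong (two *_) (ι-^ 3 (suc p)))

  module _ {C : ℕ} (1≤C : 1 ℕ.≤ C) (p : ℕ) where

    private
      m : ℕ
      m = suc (suc p)
      0<c : 0ℚ < ι C
      0<c = 0<ι {C} 1≤C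

      from-increase : (x : ℕ → ℚ) → (∀ i → 0ℚ < x i) → (∀ i → Follows (ι C) m (x i) (x (suc i))) →
                      x 0 ≤ 1ℚ → x 0 < x 1 → ∃[ i ] ι C * x i < threshold p
      from-increase x 0<x x-follows x₀≤1 x₀<x₁ with reciprocal-archimedean 0<D
        where
        0<D : 0ℚ < x 1 - x 0
        0<D = ≤-<-trans (≤-reflexive (sym (+-inverseʳ (x 0)))) (+-monoˡ-< (- x 0) x₀<x₁)
      ... | E , 1≤E , 1≤DE = reaches-threshold (ι C) 0<c p 0<x x-follows x₀≤1
          (≤-<-trans (≤-reflexive (sym (+-inverseʳ (x 0)))) (+-monoˡ-< (- x 0) x₀<x₁))
          (≤-reflexive (solve 2 (λ x y → x :+ (y :- x) := y) refl (x 0) (x 1)))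
          -- E exceeds the reciprocal of the initial gap or equals it, so C E pairs of steps bring n
          -- D up to c.
          (C ℕ.* E) (begin
            ι C                            ≡⟨ *-identityʳ (ι C) ⟨
            ι C * 1ℚ                       ≤⟨ *-monoˡ (0≤ι C) 1≤DE ⟩
            ι C * ((x 1 - x 0) * ι E)      ≡⟨ solve 3 (λ c d e → c :* (d :* e) := (c :* e) :* d) refl (ι C) (x 1 - x 0) (ι E) ⟩
            ι C * ι E * (x 1 - x 0)        ≡⟨ cong (_* (x 1 - x 0)) (ι-* C E) ⟨
            ι (C ℕ.* E) * (x 1 - x 0)      ∎)
          (1≤threshold p)
        where
        open ≤-Reasoning
        open +-*-Solver

    -- Whichever way the first step moves, one of the next two steps is an increase.
    eventually-below-threshold : (x : ℕ → ℚ) → (∀ i → 0ℚ < x i) →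
      (∀ i → Follows (ι C) m (x i) (x (suc i))) → x 0 ≢ x 1 → ∃[ i ] ι C * x i < threshold p
    eventually-below-threshold x 0<x x-follows x₀≢x₁ with <-cmp (x 0) (x 1)
    ... | tri≈ _ x₀≡x₁ _ = ⊥-elim (x₀≢x₁ x₀≡x₁)
    ... | tri> _ _ x₁<x₀ = suc (proj₁ tail) , proj₂ tail
      where
      tail : ∃[ i ] ι C * x (suc i) < threshold p
      tail = from-increase (λ i → x (suc i)) (λ i → 0<x (suc i)) (λ i → x-follows (suc i))
        (Follows⇒≤1 {m = m} (0≤ι C) (<⇒≤ (0<x 0)) (0<x 1) (x-follows 0))
        (Follows-antitone-< 0<c (<⇒≤ (0<x 1)) (0<x 2) (0<x 1) (x-follows 1) (x-follows 0) x₁<x₀)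
    -- The increase is picked up two steps later because the descent must start from a value at most
    -- 1, which the recursion guarantees only from `x 1` on.
    ... | tri< x₀<x₁ _ _ = suc (suc (proj₁ tail)) , proj₂ tail
      where
      x₂<x₁ : x 2 < x 1
      x₂<x₁ = Follows-antitone-< 0<c (<⇒≤ (0<x 0)) (0<x 1) (0<x 2) (x-follows 0) (x-follows 1) x₀<x₁
      tail : ∃[ i ] ι C * x (suc (suc i)) < threshold p
      tail = from-increase (λ i → x (suc (suc i))) (λ i → 0<x (suc (suc i))) (λ i → x-follows (suc (suc i)))
        (Follows⇒≤1 {m = m} (0≤ι C) (<⇒≤ (0<x 1)) (0<x 2) (x-follows 1))
        (Follows-antitone-< 0<c (<⇒≤ (0<x 2)) (0<x 3) (0<x 2) (x-follows 2) (x-follows 1) x₂<x₁)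

  -- Choice of δ, and passage from matching counts to the iteration.

  small-δ : ∀ n {ε} → 0ℚ < ε → ∃[ Q ] 1 ℕ.≤ Q × (1ℚ + inv Q) ^ n ≤ 1ℚ + ε
  small-δ n {ε} 0<ε with reciprocal-archimedean 0<ε
  ... | E , 1≤E , 1≤εE = Q , 1≤Q , ≤-trans ([1+δ]^n≤1+2^nδ n (<⇒≤ (inv-pos 1≤Q)) (inv≤1 1≤Q))
      (+-monoʳ-≤ 1ℚ (*-cancelˡ (0<ι {E} 1≤E) (begin
        ι E * (two ^ n * inv Q)      ≡⟨ cong (λ z → ι E * (z * inv Q)) (ι-^ 2 n) ⟨
        ι E * (ι (2 ℕ.^ n) * inv Q)  ≡⟨ solve 3 (λ e a d → e :* (a :* d) := d :* (a :* e)) refl (ι E) (ι (2 ℕ.^ n)) (inv Q) ⟩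
        inv Q * (ι (2 ℕ.^ n) * ι E)  ≡⟨ cong (inv Q *_) (ι-* (2 ℕ.^ n) E) ⟨
        inv Q * ι Q                  ≡⟨ inv-* 1≤Q ⟩
        1ℚ                           ≤⟨ 1≤εE ⟩
        ε * ι E                      ≡⟨ *-comm ε (ι E) ⟩
        ι E * ε                      ∎)))
      where
      open ≤-Reasoning
      open +-*-Solver
      Q : ℕ
      -- With δ = 1 / Q the error 2ⁿ δ equals 1 / E, which is at most ε.
      Q = 2 ℕ.^ n ℕ.* E
      1≤Q : 1 ℕ.≤ Q
      1≤Q = ℕ.*-mono-≤ (ℕ.m^n>0 2 n) 1≤E

  threshold-bound : ∀ p n {Q C} → 1 ℕ.≤ Q → (2 ℕ.* 3 ℕ.^ suc p) ℕ.^ n ℕ.* Q ℕ.≤ C → threshold p ^ n ≤ ι C * inv Q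
  threshold-bound p n {Q} {C} 1≤Q BⁿQ≤C = begin
    threshold p ^ n              ≡⟨ trans (ι-^ B n) (cong (_^ n) (ι-threshold p)) ⟨
    ι (B ℕ.^ n)                  ≡⟨ *-identityʳ _ ⟨
    ι (B ℕ.^ n) * 1ℚ             ≡⟨ cong (ι (B ℕ.^ n) *_) (inv-* 1≤Q) ⟨
    ι (B ℕ.^ n) * (inv Q * ι Q)  ≡⟨ solve 3 (λ b d q → b :* (d :* q) := (b :* q) :* d) refl (ι (B ℕ.^ n)) (inv Q) (ι Q) ⟩
    ι (B ℕ.^ n) * ι Q * inv Q    ≡⟨ cong (_* inv Q) (ι-* (B ℕ.^ n) Q) ⟨
    ι (B ℕ.^ n ℕ.* Q) * inv Q    ≤⟨ *-monoʳ (<⇒≤ (inv-pos 1≤Q)) (ι-mono-≤ {B ℕ.^ n ℕ.* Q} {C} BⁿQ≤C) ⟩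
    ι C * inv Q                  ∎
    where
    open ≤-Reasoning
    open +-*-Solver
    B : ℕ
    B = 2 ℕ.* 3 ℕ.^ suc p

  -- Multiplication by Z′ Zᵐ turns the goal into the integer identity of `fan-count`.
  frac-Follows : ∀ {j m U Z U′ Z′} → 1 ℕ.≤ Z → 1 ℕ.≤ Z′ →
                 Z′ ℕ.* Z ℕ.^ m ≡ U′ ℕ.* (Z ℕ.^ m ℕ.+ j ℕ.* U ℕ.^ m) →
                 Follows (ι j) m (frac U Z) (frac U′ Z′)
  frac-Follows {j} {m} {U} {Z} {U′} {Z′} 1≤Z 1≤Z′ eq = follows (*-cancelˡ-≡ (0<* (0<ι {Z′} 1≤Z′) (^-pos m (0<ι {Z} 1≤Z))) (begin
    ι Z′ * ι Z ^ m * (y * (1ℚ + ι j * x ^ m))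
      ≡⟨ solve 5 (λ z w y j a → z :* w :* (y :* (con 1ℚ :+ j :* a)) := (y :* z) :* (w :+ j :* (a :* w))) refl (ι Z′) (ι Z ^ m) y (ι j) (x ^ m) ⟩
    y * ι Z′ * (ι Z ^ m + ι j * (x ^ m * ι Z ^ m))
      ≡⟨ cong₂ (λ u v → u * (ι Z ^ m + ι j * v)) (frac-* U′ 1≤Z′)
           (trans (sym (^-distrib-* x (ι Z) m)) (cong (_^ m) (frac-* U 1≤Z))) ⟩
    ι U′ * (ι Z ^ m + ι j * ι U ^ m)
      ≡⟨ cong (ι U′ *_) (cong₂ _+_ (ι-^ Z m) (trans (ι-* j (U ℕ.^ m)) (cong (ι j *_) (ι-^ U m)))) ⟨
    ι U′ * (ι (Z ℕ.^ m) + ι (j ℕ.* U ℕ.^ m))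
      ≡⟨ cong (ι U′ *_) (ι-+ (Z ℕ.^ m) _) ⟨
    ι U′ * ι (Z ℕ.^ m ℕ.+ j ℕ.* U ℕ.^ m)
      ≡⟨ ι-* U′ (Z ℕ.^ m ℕ.+ j ℕ.* U ℕ.^ m) ⟨
    ι (U′ ℕ.* (Z ℕ.^ m ℕ.+ j ℕ.* U ℕ.^ m))
      ≡⟨ cong ι eq ⟨
    ι (Z′ ℕ.* Z ℕ.^ m)
      ≡⟨ trans (ι-* Z′ (Z ℕ.^ m)) (cong (ι Z′ *_) (ι-^ Z m)) ⟩
    ι Z′ * ι Z ^ m
      ≡⟨ *-identityʳ _ ⟨
    ι Z′ * ι Z ^ m * 1ℚ ∎))
    where
    open ≡-Reasoning
    open +-*-Solver
    x = frac U Z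
    y = frac U′ Z′

  -- Rational fixed points

  private
    coprime-∣-^ : ∀ {a b} n → Coprime a b → a ∣ b ℕ.^ n → a ≡ 1
    coprime-∣-^ zero    cop a∣1 = ∣1⇒≡1 a∣1
    coprime-∣-^ (suc n) cop a∣  = coprime-∣-^ n cop (coprime-divisor cop a∣)

    between : ∀ {N} m b → 1 ℕ.≤ N → b ℕ.^ suc m ℕ.+ N ℕ.* N ℕ.^ suc m ≢ b ℕ.* b ℕ.^ suc m
    between {N} m b 1≤N eq with b ℕ.≤? N
    ... | no b≰N = ℕ.<-irrefl eq (begin-strict
      b ℕ.^ suc m ℕ.+ N ℕ.* N ℕ.^ suc m
        <⟨ ℕ.+-monoʳ-< (b ℕ.^ suc m) (ℕ.*-monoʳ-< N {{ℕ.>-nonZero 1≤N}} (ℕ.^-monoˡ-< (suc m) (ℕ.≰⇒> b≰N))) ⟩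
      b ℕ.^ suc m ℕ.+ N ℕ.* b ℕ.^ suc m
        ≤⟨ ℕ.*-monoˡ-≤ (b ℕ.^ suc m) (ℕ.≰⇒> b≰N) ⟩
      b ℕ.* b ℕ.^ suc m ∎)
      where open ℕ.≤-Reasoning
    -- The case b = 0 stands apart because the strict inequality for 1 ≤ b ≤ N comes from the
    -- positive summand `b ^ suc m`.
    between {N} m zero    1≤N eq | yes _ = ℕ.<-irrefl (sym eq) (ℕ.*-mono-≤ 1≤N (ℕ.m^n>0 N {{ℕ.>-nonZero 1≤N}} (suc m)))
    between {N} m (suc b) 1≤N eq | yes b≤N = ℕ.<-irrefl (sym eq) (begin-strict
      suc b ℕ.* suc b ℕ.^ suc m    ≤⟨ ℕ.*-mono-≤ b≤N (ℕ.^-monoˡ-≤ (suc m) b≤N) ⟩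
      N ℕ.* N ℕ.^ suc m            <⟨ ℕ.+-monoˡ-≤ _ (ℕ.m^n>0 (suc b) (suc m)) ⟩
      suc b ℕ.^ suc m ℕ.+ N ℕ.* N ℕ.^ suc m ∎)
      where open ℕ.≤-Reasoning

  -- A rational fixed point would be 1/b with b an integer satisfying
  -- bᵐ (b − 1) = Nᵐ⁺¹, but the left side jumps over Nᵐ⁺¹ between b = N and b = N + 1.
  no-rational-fixpoint : ∀ {N} m {x} → 1 ℕ.≤ N → 0ℚ < x → Follows (ι (N ℕ.^ suc (suc m))) (suc m) x x → ⊥
  no-rational-fixpoint m {mkℚ ℤ.-[1+ _ ] _ _} 1≤N (*<* ())
  no-rational-fixpoint {N} m {x@(mkℚ (ℤ.+ a) b-1 c)} 1≤N _ (follows f) = between m b 1≤N (begin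
    b ℕ.^ suc m ℕ.+ C           ≡⟨ cong (b ℕ.^ suc m ℕ.+_) (ℕ.*-identityʳ C) ⟨
    b ℕ.^ suc m ℕ.+ C ℕ.* 1     ≡⟨ cong (λ u → b ℕ.^ suc m ℕ.+ C ℕ.* u) (ℕ.^-zeroˡ (suc m)) ⟨
    b ℕ.^ suc m ℕ.+ C ℕ.* 1 ℕ.^ suc m ≡⟨ ℕ.*-identityˡ _ ⟨
    1 ℕ.* (b ℕ.^ suc m ℕ.+ C ℕ.* 1 ℕ.^ suc m) ≡⟨ cong (λ a → a ℕ.* (b ℕ.^ suc m ℕ.+ C ℕ.* a ℕ.^ suc m)) a≡1 ⟨
    a ℕ.* (b ℕ.^ suc m ℕ.+ C ℕ.* a ℕ.^ suc m) ≡⟨ integral ⟩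
    b ℕ.* b ℕ.^ suc m           ∎)
    where
    open ≡-Reasoning
    open +-*-Solver
    b C : ℕ
    b = suc b-1
    C = N ℕ.^ suc (suc m)
    xb≡a : x * ι b ≡ ι a
    xb≡a = numerator-* {a} {b-1} {c}
    integral : a ℕ.* (b ℕ.^ suc m ℕ.+ C ℕ.* a ℕ.^ suc m) ≡ b ℕ.* b ℕ.^ suc m
    integral = ι-injective {a ℕ.* (b ℕ.^ suc m ℕ.+ C ℕ.* a ℕ.^ suc m)} {b ℕ.* b ℕ.^ suc m} (begin
      ι (a ℕ.* (b ℕ.^ suc m ℕ.+ C ℕ.* a ℕ.^ suc m))
        ≡⟨ trans (ι-* a (b ℕ.^ suc m ℕ.+ C ℕ.* a ℕ.^ suc m)) (cong (ι a *_) (trans (ι-+ (b ℕ.^ suc m) (C ℕ.* a ℕ.^ suc m))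
             (cong₂ _+_ (ι-^ b (suc m)) (trans (ι-* C (a ℕ.^ suc m)) (cong (ι C *_) (ι-^ a (suc m))))))) ⟩
      ι a * (ι b ^ suc m + ι C * ι a ^ suc m)
        ≡⟨ cong₂ (λ u v → u * (ι b ^ suc m + ι C * v)) (sym xb≡a)
             (trans (cong (_^ suc m) (sym xb≡a)) (^-distrib-* x (ι b) (suc m))) ⟩
      x * ι b * (ι b ^ suc m + ι C * (x ^ suc m * ι b ^ suc m))
        ≡⟨ solve 5 (λ x b w c a → x :* b :* (w :+ c :* (a :* w)) := x :* (con 1ℚ :+ c :* a) :* (b :* w)) refl x (ι b) (ι b ^ suc m) (ι C) (x ^ suc m) ⟩
      x * (1ℚ + ι C * x ^ suc m) * (ι b * ι b ^ suc m)
        ≡⟨ trans (cong (_* (ι b * ι b ^ suc m)) f) (*-identityˡ _) ⟩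
      ι b * ι b ^ suc m
        ≡⟨ trans (ι-* b (b ℕ.^ suc m)) (cong (ι b *_) (ι-^ b (suc m))) ⟨
      ι (b ℕ.* b ℕ.^ suc m) ∎)
    -- As in the rational root theorem: a divides a power of b, yet a / b is in lowest terms.
    a≡1 : a ≡ 1
    a≡1 = coprime-∣-^ (suc (suc m)) (Coprimality.recompute c)
            (subst (a ∣_) integral (m∣m*n (b ℕ.^ suc m ℕ.+ C ℕ.* a ℕ.^ suc m)))

-- The final graph and the choice of parameters.

module Assembly where

  open Graphs
  open Hypergraphs
  open Rationals
  open Dynamics
  open import Defs hiding (n; m)
  open import Data.Nat as ℕ using (ℕ; zero; suc; s≤s; z≤n)
  import Data.Nat.Properties as ℕ
  import Data.Nat.Solver as ℕ
  open import Data.Fin using (Fin; zero; _↑ʳ_)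
  open import Data.Fin.Subset using (⊥; ⁅_⁆; outside)
  import Data.Vec as Vec
  open import Data.Rational
  open import Data.Rational.Properties
  open import Data.Product using (Σ; _×_; _,_; proj₁; proj₂)
  open import Relation.Binary.PropositionalEquality

  private
    ⁅↑ʳ⁆ : ∀ a {b} (v : Fin b) → ⁅ a ↑ʳ v ⁆ ≡ ⊥ {a} Vec.++ ⁅ v ⁆
    ⁅↑ʳ⁆ zero    v = refl
    ⁅↑ʳ⁆ (suc a) v = cong (outside Vec.∷_) (⁅↑ʳ⁆ a v)

  Puncov≡ : ∀ {n} (es : Edges n) v → Puncov (hypergraph es) v ≡ frac (#avoiding es ⁅ v ⁆) (#avoiding es ⊥)
  Puncov≡ es v = cong₂ frac (#uncovering es v) (#matchings es)

  rootProbability : ∀ {n} → Edges (suc n) → ℚ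
  rootProbability es = frac (#avoiding es root) (#avoiding es ⊥)

  private
    frac-*-cancelʳ : ∀ a b d → 1 ℕ.≤ b → 1 ℕ.≤ d → frac (a ℕ.* d) (b ℕ.* d) ≡ frac a b
    frac-*-cancelʳ a b d 1≤b 1≤d = sym (frac-unique (a ℕ.* d) (ℕ.*-mono-≤ 1≤b 1≤d)
      (trans (cong (frac a b *_) (ι-* b d)) (trans (sym (*-assoc (frac a b) (ι b) (ι d)))
        (trans (cong (_* ι d) (frac-* a 1≤b)) (sym (ι-* a d))))))

  module _ {a b} (A : Edges (suc a)) (B : Edges (suc b)) where

    private
      total-⊎ : #avoiding (A ⊎ᴱ B) ⊥ ≡ #avoiding A ⊥ ℕ.* #avoiding B ⊥
      total-⊎ = trans (cong (#avoiding (A ⊎ᴱ B)) (sym (replicate-++ (suc a) (suc b) outside))) (#avoiding-⊎ A B ⊥ ⊥)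

    -- Matching counts multiply over a disjoint union, so the factor from B cancels.
    Puncov-⊎ˡ : Puncov (hypergraph (A ⊎ᴱ B)) zero ≡ rootProbability A
    Puncov-⊎ˡ = trans (Puncov≡ (A ⊎ᴱ B) zero) (trans (cong₂ frac
      (trans (cong (#avoiding (A ⊎ᴱ B)) (cong (_ Vec.∷_) (sym (replicate-++ a (suc b) outside)))) (#avoiding-⊎ A B root ⊥))
      total-⊎) (frac-*-cancelʳ _ _ _ (#avoiding>0 A ⊥) (#avoiding>0 B ⊥)))

    Puncov-⊎ʳ : Puncov (hypergraph (A ⊎ᴱ B)) (suc a ↑ʳ zero) ≡ rootProbability B
    Puncov-⊎ʳ = trans (Puncov≡ (A ⊎ᴱ B) (suc a ↑ʳ zero)) (trans (cong₂ frac
      (trans (cong (#avoiding (A ⊎ᴱ B)) (⁅↑ʳ⁆ (suc a) zero))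
        (trans (#avoiding-⊎ A B ⊥ root) (ℕ.*-comm (#avoiding A ⊥) _)))
      (trans total-⊎ (ℕ.*-comm (#avoiding A ⊥) _))) (frac-*-cancelʳ _ _ _ (#avoiding>0 B ⊥) (#avoiding>0 A ⊥)))

  unite : ∀ {m d} (R S : RegularGraph m d) {low high : ℚ} →
          low < rootProbability (RegularGraph.edges R) → rootProbability (RegularGraph.edges S) < high →
          Σ Hypergraph λ H → Uniform (suc m) H × Regular d H × Linear H ×
          Σ (Fin (Hypergraph.n H)) λ v₁ → Σ (Fin (Hypergraph.n H)) λ v₂ →
          (low < Puncov H v₁) × (Puncov H v₂ < high)
  unite {m} {d} R S low< <high =
    hypergraph (A ⊎ᴱ B) , hypergraph-Uniform (proj₁ lu) ,
    hypergraph-Regular (A ⊎ᴱ B) (trans (degrees-⊎ A B)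
      (trans (cong₂ Vec._++_ (RegularGraph.degrees≡ R) (RegularGraph.degrees≡ S)) (replicate-++ (suc a) (suc b) d))) ,
    hypergraph-Linear (proj₂ lu) ,
    zero , suc a ↑ʳ zero ,
    <-respʳ-≡ (sym (Puncov-⊎ˡ A B)) low< ,
    <-respˡ-≡ (sym (Puncov-⊎ʳ A B)) <high
    where
    a b : ℕ
    a = RegularGraph.others R
    b = RegularGraph.others S
    A : Edges (suc a)
    A = RegularGraph.edges R
    B : Edges (suc b)
    B = RegularGraph.edges S
    lu : LinearUniform (suc m) (A ⊎ᴱ B)
    lu = LinearUniform-⊎ (RegularGraph.linearUniform R) (RegularGraph.linearUniform S)

  module _ (m : ℕ) where

    gadgetProbability : ∀ {c} → Gadget m c → ℚ
    gadgetProbability G = rootProbability (edges G)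

    fan-Follows : ∀ j {c} (G : Gadget m c) → Follows (ι j) m (gadgetProbability G) (rootProbability (fan m j (edges G) root))
    fan-Follows j G = frac-Follows {j} {m} {U′ = #avoiding F root}
      (#avoiding>0 (edges G) ⊥) (#avoiding>0 F ⊥) (fan-count m j (edges G))
      where F = fan m j (edges G) root

    rootProbability>0 : ∀ {n} (es : Edges (suc n)) → 0ℚ < rootProbability es
    rootProbability>0 es = frac-pos (#avoiding>0 es root) (#avoiding>0 es ⊥)

  module Construction (p : ℕ) {ε δ : ℚ} {N C : ℕ} (G₀ : Gadget (2 ℕ.+ p) C)
    (C≡ : C ≡ N ℕ.^ (3 ℕ.+ p)) (1≤N : 1 ℕ.≤ N) (1≤C : 1 ℕ.≤ C) (0<ε : 0ℚ < ε) (0≤δ : 0ℚ ≤ δ)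
    (δ-small : (1ℚ + δ) ^ ((3 ℕ.+ p) ℕ.* (2 ℕ.+ p)) ≤ 1ℚ + ε) (Bᵐ≤cδ : threshold p ^ (2 ℕ.+ p) ≤ ι C * δ) where

    private
      m : ℕ
      m = 2 ℕ.+ p
      0<c : 0ℚ < ι C
      0<c = 0<ι {C} 1≤C
      δ-smallᵐ : (1ℚ + δ) ^ m ≤ 1ℚ + ε
      -- The exponent in `δ-small` is m + m · m, and the power with exponent m · m is at least 1.
      δ-smallᵐ = ≤-trans (≤-trans (≤-reflexive (sym (*-identityʳ _)))
        (*-monoˡ (^-nonNeg m 0≤1+δ) (1≤^ (m ℕ.* m) (p≤p+q 0≤δ)))) (≤-trans (≤-reflexive (sym (^-homo-* (1ℚ + δ) m (m ℕ.* m)))) δ-small)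
        where
        0≤1+δ : 0ℚ ≤ 1ℚ + δ
        0≤1+δ = ≤-trans 0≤1 (p≤p+q 0≤δ)
      1≤cδ : 1ℚ ≤ ι C * δ
      1≤cδ = ≤-trans (1≤^ m (1≤threshold p)) Bᵐ≤cδ
      1≤c : 1ℚ ≤ ι C
      1≤c = ι-mono-≤ {1} {C} 1≤C

      G : ℕ → Gadget m C
      G zero    = G₀
      G (suc i) = next m (G i)
      x : ℕ → ℚ
      x i = gadgetProbability m (G i)
      0<x : ∀ i → 0ℚ < x i
      0<x i = rootProbability>0 m (edges (G i))
      x-follows : ∀ i → Follows (ι C) m (x i) (x (suc i))
      x-follows i = fan-Follows m C (G i)
      x₀≢x₁ : x 0 ≢ x 1
      x₀≢x₁ eq = no-rational-fixpoint (suc p) 1≤N (0<x 0)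
        (subst (λ c → Follows (ι c) m (x 0) (x 0)) C≡ (subst (Follows (ι C) m (x 0)) (sym eq) (x-follows 0)))

      below = eventually-below-threshold {C} 1≤C p x 0<x x-follows x₀≢x₁
      i = proj₁ below

      T : ℕ → RegularGraph m (suc C)
      T i = cap m (G i)
      T-edges : ∀ i → Edges (suc (fanSize m (suc (Gadget.others (G i))) (suc C)))
      T-edges i = fan m (suc C) (edges (G i)) root
      T-follows : ∀ i → Follows (1ℚ + ι C) m (x i) (rootProbability (T-edges i))
      T-follows i = subst (λ d → Follows d m (x i) (rootProbability (T-edges i))) (ι-suc C) (fan-Follows m (suc C) (G i))

      1≤y[1+δ] : 1ℚ ≤ x (suc i) * (1ℚ + δ)
      1≤y[1+δ] = below-threshold (ι C) 0<c p (0<x i) (0<x (suc i)) 1≤c Bᵐ≤cδ (x-follows i) (proj₂ below)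

    d : ℕ
    d = suc C

    -- The value at i is below the threshold. Hence the gadget at i + 1 has a root that is almost
    -- surely uncovered and blocks the cap's root often, whereas the one at i + 2 has probability of
    -- order 1/c and rarely competes for it.
    left right : RegularGraph m d
    left  = T (suc (suc i))
    right = T (suc i)

    left-uncovered : 1ℚ - (1ℚ + ε) * inv (d ℕ.^ suc p) < rootProbability (RegularGraph.edges left)
    left-uncovered = root-uncovered (ι C) 0<c p {ε = ε} (0<x (suc i)) (0<x (suc (suc i))) 0≤δ δ-small 1≤cδ
      (rootProbability>0 m (T-edges (suc (suc i)))) (<⇒≤ (inv-pos (ℕ.m^n>0 d (suc p)))) 1≤y[1+δ] (x-follows (suc i)) (T-follows (suc (suc i)))
      (trans (cong (inv (d ℕ.^ suc p) *_) (sym (trans (ι-^ d (suc p)) (cong (_^ suc p) (ι-suc C))))) (inv-* (ℕ.m^n>0 d (suc p))))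

    right-covered : rootProbability (RegularGraph.edges right) < (1ℚ + ε) * inv (suc d)
    right-covered = root-covered (ι C) 0<c p (0<x (suc i)) 0≤δ δ-smallᵐ 0<ε
      (rootProbability>0 m (T-edges (suc i))) 1≤y[1+δ] (T-follows (suc i))
      (trans (cong (inv (suc d) *_) (sym (trans (ι-suc d) (cong (λ z → 1ℚ + z) (ι-suc C))))) (inv-* {suc d} (s≤s z≤n)))

    construction : Σ Hypergraph λ H → Uniform (3 ℕ.+ p) H × Regular d H × Linear H ×
      Σ (Fin (Hypergraph.n H)) λ v₁ → Σ (Fin (Hypergraph.n H)) λ v₂ →
      (1ℚ - (1ℚ + ε) * inv (d ℕ.^ (1 ℕ.+ p)) < Puncov H v₁) × (Puncov H v₂ < (1ℚ + ε) * inv (suc d))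
    construction = unite left right left-uncovered right-covered

  Conclusion : ℕ → ℚ → ℚ → Set
  Conclusion p d₀ ε =
    Σ ℕ λ d → d₀ < ι d × Σ Hypergraph λ H → Uniform (3 ℕ.+ p) H × Regular d H × Linear H ×
    Σ (Fin (Hypergraph.n H)) λ v₁ → Σ (Fin (Hypergraph.n H)) λ v₂ →
    (1ℚ - (1ℚ + ε) * inv (d ℕ.^ (1 ℕ.+ p)) < Puncov H v₁) × (Puncov H v₂ < (1ℚ + ε) * inv (suc d))

  module Parameters (p : ℕ) {d₀ ε : ℚ} (0<ε : 0ℚ < ε) {n₀ Q : ℕ} (d₀≤n₀ : d₀ ≤ ι n₀) (1≤Q : 1 ℕ.≤ Q)
    (δ-small : (1ℚ + inv Q) ^ ((3 ℕ.+ p) ℕ.* (2 ℕ.+ p)) ≤ 1ℚ + ε) where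

    private
      k m BᵐQ : ℕ
      k = 3 ℕ.+ p
      m = 2 ℕ.+ p
      BᵐQ = (2 ℕ.* 3 ℕ.^ suc p) ℕ.^ m ℕ.* Q

    -- Two arithmetic demands meet on C: being a k-th power excludes a rational fixed point, and
    -- being a multiple of k allows the initial gadget.
    from-size : ∀ N C t → C ≡ N ℕ.^ k → 1 ℕ.≤ N → C ≡ t ℕ.* k → n₀ ℕ.≤ C → BᵐQ ℕ.≤ C → Conclusion p d₀ ε
    from-size N C t C≡Nᵏ 1≤N C≡tk n₀≤C BᵐQ≤C = suc C , d₀<d ,
      Construction.construction p {δ = inv Q} {N = N} (subst (Gadget m) (sym C≡tk) (initialGadget m t)) C≡Nᵏ 1≤N
        (subst (1 ℕ.≤_) (sym C≡Nᵏ) (ℕ.m^n>0 N {{ℕ.>-nonZero 1≤N}} k)) 0<ε (<⇒≤ (inv-pos 1≤Q)) δ-small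
        (threshold-bound p m {Q} {C} 1≤Q BᵐQ≤C)
      where
      d₀<d : d₀ < ι (suc C)
      d₀<d = ≤-<-trans (≤-trans d₀≤n₀ (ι-mono-≤ {n₀} {C} n₀≤C))
        (<-respʳ-≡ (sym (ι-suc C)) (<-≤-trans (p<p+q {ι C} 0<1) (≤-reflexive (+-comm (ι C) 1ℚ))))

    from-scale : ∀ R → 1 ℕ.≤ R → n₀ ℕ.≤ R → BᵐQ ℕ.≤ R → Conclusion p d₀ ε
    from-scale R 1≤R n₀≤R BᵐQ≤R =
      -- Taking N = k R makes Nᵏ divisible by k, and it is at least R, which absorbs all lower
      -- bounds.
      from-size (k ℕ.* R) ((k ℕ.* R) ℕ.^ k) (R ℕ.* (k ℕ.* R) ℕ.^ m) refl 1≤kR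
        (solve 3 (λ k r n → (k :* r) :* n := r :* n :* k) refl k R ((k ℕ.* R) ℕ.^ m))
        (ℕ.≤-trans n₀≤R R≤C) (ℕ.≤-trans BᵐQ≤R R≤C)
      where
      open ℕ.+-*-Solver
      1≤kR : 1 ℕ.≤ k ℕ.* R
      1≤kR = ℕ.*-mono-≤ {1} {k} (s≤s z≤n) 1≤R
      R≤C : R ℕ.≤ (k ℕ.* R) ℕ.^ k
      R≤C = ℕ.≤-trans (ℕ.m≤n*m R k)
        (ℕ.m≤m*n (k ℕ.* R) ((k ℕ.* R) ℕ.^ m) {{ℕ.>-nonZero (ℕ.m^n>0 (k ℕ.* R) {{ℕ.>-nonZero 1≤kR}} m)}})

    conclusion : Conclusion p d₀ ε
    conclusion = from-scale (suc (n₀ ℕ.+ BᵐQ)) (s≤s z≤n) (ℕ.m≤n⇒m≤1+n (ℕ.m≤m+n n₀ BᵐQ)) (ℕ.m≤n⇒m≤1+n (ℕ.m≤n+m BᵐQ n₀))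

  construction-exists : ∀ p (d₀ ε : ℚ) → 0ℚ < ε → Conclusion p d₀ ε
  construction-exists p d₀ ε 0<ε =
    let n₀ , d₀≤n₀        = ≤-archimedean d₀
        Q , 1≤Q , δ-small = small-δ ((3 ℕ.+ p) ℕ.* (2 ℕ.+ p)) 0<ε
    in Parameters.conclusion p 0<ε {n₀} {Q} d₀≤n₀ 1≤Q δ-small

open import Defs
open import Data.Nat using (ℕ; suc; _^_; _∸_)
open import Data.Integer using (+_)
open import Data.Rational using (ℚ; 0ℚ; 1ℚ; _<_; _+_; _-_; _*_; _/_)
open import Data.Product using (Σ; _×_)
open import Data.Fin using (Fin)

theorem1p4 : (k : ℕ) → 2 Data.Nat.< k → (d₀ ε : ℚ) → 0ℚ < d₀ → 0ℚ < ε →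
    Σ ℕ λ d → d₀ < (+ d) / 1 ×
    Σ Hypergraph λ H → Uniform k H × Regular d H × Linear H ×
    Σ (Fin (n H)) λ v₁ → Σ (Fin (n H)) λ v₂ →
    (1ℚ - (1ℚ + ε) * inv (d ^ (k ∸ 2)) < Puncov H v₁) ×
    (Puncov H v₂ < (1ℚ + ε) * inv (suc d))
-- Matching k as 3 + p makes `k ∸ 2` compute to 1 + p, the exponent m - 1 of the construction.
theorem1p4 (suc (suc (suc p))) (Data.Nat.s≤s (Data.Nat.s≤s (Data.Nat.s≤s Data.Nat.z≤n))) d₀ ε _ 0<ε =
  Assembly.construction-exists p d₀ ε 0<ε
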